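{- For any integer $t\ge 1$ and any prime $p>t$, $$H_{p-1}^q(\{2\}^t)\equiv (-1)^t\binom{p+t}{2t+1}\frac{(1-q)^{2t}}{p(t+1)} \pmod{[p]_q}.$$
   Context: Here $q$ is an indeterminate and $[n]_q=\frac{1-q^n}{1-q}=1+q+\cdots+q^{n-1}$. For positive integers $s_1,\dots,s_l$, $$H_n^q(s_1,\ldots,s_l)=\sum_{1\le k_1<\cdots<k_l\le n}\prod_{i=1}^l\frac{q^{(s_i-1)k_i}}{[k_i]_q^{s_i}}.$$ $\{s\}^t$ denotes $t$ consecutive copies of $s$. For a prime $p$ and rational functions $A,B$ in $q$, $A\equiv B\pmod{[p]_q}$ means $A-B=f/g$ with $f,g$ polynomials in $q$ with integer coefficients, $g$ coprime to $[p]_q$ in $\mathbb{Q}[q]$, and $[p]_q\mid f$ ($[p]_q$ is the $p$th cyclotomic polynomial, irreducible over $\mathbb{Q}$). -}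

module Defs where

open import Algebra.Bundles using (RawRing)
import Algebra.Definitions.RawSemiring as RawSemiringDefinitions
open import Data.Empty using (⊥-elim)
open import Data.Integer.Base as ℤ using (ℤ; +_; 0ℤ; 1ℤ)
import Data.Integer.Properties as ℤ
open import Data.List.Base as List using (List; []; _∷_; _++_)
open import Data.Nat.Base as ℕ using (ℕ; zero; suc; NonZero)
open import Data.Product.Base using (Σ-syntax; ∃₂; _×_)
open import Data.Rational.Base as ℚ using (ℚ)
open import Data.Sum.Base using (_⊎_; inj₁; inj₂; [_,_]′)
open import Data.Vec.Base as Vec using (Vec; []; _∷_)
open import Level using (0ℓ)
open import Relation.Binary.PropositionalEquality
  using (_≡_; refl; sym; trans; cong; cong₂)
open import Relation.Nullary.Decidable.Core using (yes; no)
open import Relation.Nullary.Negation.Core using (¬_)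

-- Univariate polynomials as coefficient lists, constant term first.
-- Trailing zeros are allowed, so equality is coefficientwise.

module Polynomial {c ℓ} (R : RawRing c ℓ) where
  open RawRing R renaming (Carrier to A)

  coeff : List A → ℕ → A
  coeff []      _       = 0#
  coeff (a ∷ f) zero    = a
  coeff (a ∷ f) (suc n) = coeff f n

  infixl 6 _⊕_
  infixl 7 _⊛_

  _⊕_ : List A → List A → List A
  []      ⊕ g       = g
  (a ∷ f) ⊕ []      = a ∷ f
  (a ∷ f) ⊕ (b ∷ g) = (a + b) ∷ (f ⊕ g)

  _⊛_ : List A → List A → List A
  []      ⊛ g = []
  (a ∷ f) ⊛ g = List.map (a *_) g ⊕ (0# ∷ f ⊛ g)

  rawRing : RawRing c ℓ
  rawRing = record
    { Carrier = List A
    ; _≈_     = λ f g → ∀ n → coeff f n ≈ coeff g n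
    ; _+_     = _⊕_
    ; _*_     = _⊛_
    ; -_      = List.map (-_)
    ; 0#      = []
    ; 1#      = 1# ∷ []
    }

module ℤ[q] where
  open Polynomial ℤ.+-*-rawRing public using (coeff)
  open RawRing (Polynomial.rawRing ℤ.+-*-rawRing) public
  open RawSemiringDefinitions rawSemiring public using (_^_; _∣_)

module ℚ[q] where
  open RawRing (Polynomial.rawRing ℚ.+-*-rawRing) public
  open RawSemiringDefinitions rawSemiring public using (Coprime)

ℤ[q]→ℚ[q] : ℤ[q].Carrier → ℚ[q].Carrier
ℤ[q]→ℚ[q] = List.map (ℚ._/ 1)

-- ℤ[q] has no zero divisors, as needed to multiply denominators.

module _ where
  open ℤ[q]
  open Polynomial ℤ.+-*-rawRing using (_⊕_; _⊛_)

  coeff-⊕ : ∀ f g n → coeff (f ⊕ g) n ≡ coeff f n ℤ.+ coeff g n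
  coeff-⊕ []      g       n       = sym (ℤ.+-identityˡ _)
  coeff-⊕ (a ∷ f) []      n       = sym (ℤ.+-identityʳ _)
  coeff-⊕ (a ∷ f) (b ∷ g) zero    = refl
  coeff-⊕ (a ∷ f) (b ∷ g) (suc n) = coeff-⊕ f g n

  coeff-scale : ∀ a f n → coeff (List.map (a ℤ.*_) f) n ≡ a ℤ.* coeff f n
  coeff-scale a []      n       = sym (ℤ.*-zeroʳ a)
  coeff-scale a (b ∷ f) zero    = refl
  coeff-scale a (b ∷ f) (suc n) = coeff-scale a f n

  coeff-⊛-zero : ∀ a f g → coeff ((a ∷ f) ⊛ g) zero ≡ a ℤ.* coeff g zero
  coeff-⊛-zero a f g =
    trans (coeff-⊕ (List.map (a ℤ.*_) g) (0ℤ ∷ f ⊛ g) zero)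
          (trans (ℤ.+-identityʳ _) (coeff-scale a g zero))

  coeff-⊛-suc : ∀ a f g n →
    coeff ((a ∷ f) ⊛ g) (suc n) ≡ a ℤ.* coeff g (suc n) ℤ.+ coeff (f ⊛ g) n
  coeff-⊛-suc a f g n =
    trans (coeff-⊕ (List.map (a ℤ.*_) g) (0ℤ ∷ f ⊛ g) (suc n))
          (cong (ℤ._+ coeff (f ⊛ g) n) (coeff-scale a g (suc n)))

  ⊛-shiftʳ : ∀ f g → f ⊛ (0ℤ ∷ g) ≈ 0ℤ ∷ f ⊛ g
  ⊛-shiftʳ []      g zero    = refl
  ⊛-shiftʳ []      g (suc n) = refl
  ⊛-shiftʳ (a ∷ f) g zero    =
    trans (coeff-⊛-zero a f (0ℤ ∷ g)) (ℤ.*-zeroʳ a)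
  ⊛-shiftʳ (a ∷ f) g (suc n) =
    trans (coeff-⊛-suc a f (0ℤ ∷ g) n)
      (trans (cong₂ ℤ._+_ (sym (coeff-scale a g n)) (⊛-shiftʳ f g n))
             (sym (coeff-⊕ (List.map (a ℤ.*_) g) (0ℤ ∷ f ⊛ g) n)))

  ⊛-cancel-unshifted : ∀ a f g → ¬ a ≡ 0ℤ → (a ∷ f) ⊛ g ≈ 0# → g ≈ 0#
  ⊛-cancel-unshifted a f []      a≢0 fg≈0 n = refl
  ⊛-cancel-unshifted a f (b ∷ g) a≢0 fg≈0
    with ℤ.i*j≡0⇒i≡0∨j≡0 a (trans (sym (coeff-⊛-zero a f (b ∷ g))) (fg≈0 0))
  ... | inj₁ a≡0  = ⊥-elim (a≢0 a≡0)
  ... | inj₂ refl = λ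
    { zero    → refl
    ; (suc n) → ⊛-cancel-unshifted a f g a≢0
        (λ m → trans (sym (⊛-shiftʳ (a ∷ f) g (suc m))) (fg≈0 (suc m))) n
    }

  noZeroDivisors : ∀ f g → f * g ≈ 0# → f ≈ 0# ⊎ g ≈ 0#
  noZeroDivisors []      g fg≈0 = inj₁ λ _ → refl
  noZeroDivisors (a ∷ f) g fg≈0 with a ℤ.≟ 0ℤ
  ... | no  a≢0  = inj₂ (⊛-cancel-unshifted a f g a≢0 fg≈0)
  ... | yes refl with noZeroDivisors f g
                        (λ n → trans (sym (trans (coeff-⊛-suc 0ℤ f g n) (ℤ.+-identityˡ _)))
                                     (fg≈0 (suc n)))
  ...   | inj₁ f≈0 = inj₁ λ { zero → refl ; (suc n) → f≈0 n }
  ...   | inj₂ g≈0 = inj₂ g≈0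

  *-≉0 : ∀ {f g} → f ≉ 0# → g ≉ 0# → f * g ≉ 0#
  *-≉0 {f} {g} f≉0 g≉0 fg≈0 = [ f≉0 , g≉0 ]′ (noZeroDivisors f g fg≈0)

  1≉0 : 1# ≉ 0#
  1≉0 1≈0 with () ← 1≈0 0

  ^-≉0 : ∀ {f} n → f ≉ 0# → f ^ n ≉ 0#
  ^-≉0 zero    f≉0 = 1≉0
  ^-≉0 {f} (suc n) f≉0 = *-≉0 {f} {f ^ n} f≉0 (^-≉0 {f} n f≉0)

-- Rational functions in q, as the field of fractions of ℤ[q].

record ℚ⟨q⟩ : Set where
  constructor frac
  field
    num   : ℤ[q].Carrier
    den   : ℤ[q].Carrier
    den≉0 : den ℤ[q].≉ ℤ[q].0#

fractions : RawRing 0ℓ 0ℓ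
fractions = record
  { Carrier = ℚ⟨q⟩
  ; _≈_ = λ (frac f g _) (frac f′ g′ _) → f * g′ ≈ f′ * g
  ; _+_ = λ (frac f g g≉0) (frac f′ g′ g′≉0) →
      frac (f * g′ + f′ * g) (g * g′) (*-≉0 {g} {g′} g≉0 g′≉0)
  ; _*_ = λ (frac f g g≉0) (frac f′ g′ g′≉0) →
      frac (f * f′) (g * g′) (*-≉0 {g} {g′} g≉0 g′≉0)
  ; -_  = λ (frac f g g≉0) → frac (- f) g g≉0
  ; 0#  = frac 0# 1# 1≉0
  ; 1#  = frac 1# 1# 1≉0
  } where open ℤ[q]

open RawRing fractions public using (_≈_; _+_; _*_; -_; 0#; 1#)
open RawSemiringDefinitions (RawRing.rawSemiring fractions) public using (_^_)

infixl 6 _-_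
_-_ : ℚ⟨q⟩ → ℚ⟨q⟩ → ℚ⟨q⟩
A - B = A + (- B)

fromPoly : ℤ[q].Carrier → ℚ⟨q⟩
fromPoly f = frac f ℤ[q].1# 1≉0

fromℕ : ℕ → ℚ⟨q⟩
fromℕ n = fromPoly (+ n ∷ [])

q : ℚ⟨q⟩
q = fromPoly (0ℤ ∷ 1ℤ ∷ [])

constant≉0 : ∀ n .{{_ : NonZero n}} → (+ n ∷ []) ℤ[q].≉ ℤ[q].0#
constant≉0 (suc n) n≈0 with () ← n≈0 0

infixl 7 _/ℕ_
_/ℕ_ : ℚ⟨q⟩ → (n : ℕ) .{{_ : NonZero n}} → ℚ⟨q⟩
A /ℕ n = A * frac ℤ[q].1# (+ n ∷ []) (constant≉0 n)

-- 1 + q + ⋯ + qⁿ⁻¹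

[_]q : ℕ → ℤ[q].Carrier
[ n ]q = List.replicate n 1ℤ

[suc_]q≉0 : ∀ n → [ suc n ]q ℤ[q].≉ ℤ[q].0#
[suc n ]q≉0 eq with () ← eq 0

-- subsequences l xs lists the length-l subsequences of xs; for strictly
-- increasing xs these are exactly the strictly increasing l-tuples with
-- entries in xs, each listed once.

subsequences : ∀ {A : Set} (l : ℕ) → List A → List (Vec A l)
subsequences zero    xs       = [] ∷ []
subsequences (suc l) []       = []
subsequences (suc l) (x ∷ xs) =
  List.map (x ∷_) (subsequences l xs) ++ subsequences (suc l) xs

-- factor s j is q^((s - 1) k) / [k]^s at k = j + 1: the summation index is
-- shifted so that [k] is visibly nonzero.  Exponents s are meant to be
-- positive, so the subtraction does not truncate.

factor : ℕ → ℕ → ℚ⟨q⟩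
factor s j =
  q ^ ((s ℕ.∸ 1) ℕ.* suc j) *
  frac ℤ[q].1# ([ suc j ]q ℤ[q].^ s) (^-≉0 {[ suc j ]q} s [suc j ]q≉0)

-- upTo n = 0, …, n - 1, so that k = j + 1 ranges over 1, …, n.

H : ∀ {l} → ℕ → Vec ℕ l → ℚ⟨q⟩
H {l} n s = List.foldr _+_ 0#
  (List.map (λ js → Vec.foldr′ _*_ 1# (Vec.zipWith factor s js))
            (subsequences l (List.upTo n)))

infix 4 _≡_[mod_]
_≡_[mod_] : ℚ⟨q⟩ → ℚ⟨q⟩ → ℤ[q].Carrier → Set
A ≡ B [mod Φ ] = ∃₂ λ f g → Σ[ g≉0 ∈ g ℤ[q].≉ ℤ[q].0# ]
    A - B ≈ frac f g g≉0
  × ℚ[q].Coprime (ℤ[q]→ℚ[q] g) (ℤ[q]→ℚ[q] Φ)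
  × Φ ℤ[q].∣ f

{-# OPTIONS --safe #-}

-- In ℤ[q] modulo [p] we have qᵖ = 1, and [1], …, [p-1] are units.  Write e_t for
-- the t-th elementary symmetric function of the qᵏ / [k]², 0 < k < p.  Comparing
-- coefficients in the q-difference equation (1 - qX) F(qX) = (1 - X) F(X) of
-- F(X) = ∏ (1 - qᵏX) gives F(X) = 1 + X + ⋯ + Xᵖ⁻¹, so the identity
--   α (1 - y)² - (1 - α)² y = (α - y) (1 - α y)   at y = qᵏ
-- turns the product of the left-hand sides over k into ((1 - αᵖ) / (1 - α))².
-- Expand αᵖ + α⁻ᵖ - 2 in powers of (1 - α)² / α (a Lucas-type polynomial with
-- binomial coefficients) and compare coefficients of ((1 - α)²)ᵗ αᵖ⁻¹⁻ᵗ, working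
-- in power series in β = 1 - α: this determines p² e_t up to the factor
-- (-(1 - q)²)ᵗ.  Cancelling integers is harmless since numerator and denominator
-- of a fraction may be scaled by an integer.

module Submission where

open import Defs using (subsequences)
open import Algebra.Bundles using (CommutativeRing; RawRing)
import Algebra.Morphism.RingMonomorphism as RingMonomorphism
open import Algebra.Morphism.Structures using (IsRingHomomorphism; IsRingMonomorphism)
import Algebra.Properties.Group as GroupProperties
import Algebra.Properties.Ring as RingProperties
import Algebra.Properties.Semiring.Exp as Exponentiation
import Algebra.Properties.Semiring.Mult as Multiples
import Algebra.Properties.Semiring.Mult.TCOptimised as OptimisedMultiples
import Algebra.Solver.Ring as RingSolver
open import Algebra.Solver.Ring.AlmostCommutativeRing
  using (fromCommutativeRing; _-Raw-AlmostCommutative⟶_)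
open import Data.Integer.Base as ℤ using (ℤ; +_; -[1+_]; 0ℤ; 1ℤ)
import Data.Integer.Properties as ℤ
open import Data.List.Base as List using (List; []; _∷_; _++_)
import Data.List.Properties as List
open import Data.List.Relation.Unary.All as All using (All; []; _∷_)
import Data.List.Relation.Unary.All.Properties as All
open import Data.Maybe.Base as Maybe using ()
open import Data.Nat.Base as ℕ
  using (ℕ; zero; suc; _∸_; _≥_; _≤_; _<_; NonZero; z≤n; s≤s)
open import Data.Nat.Combinatorics
  using (_C_; nC1≡n; nCk+nC[k+1]≡[n+1]C[k+1]; k>n⇒nCk≡0)
open import Data.Nat.Coprimality using (Coprime; coprime-Bézout; prime⇒coprime)
open import Data.Nat.GCD using (module Bézout)
open import Data.Nat.Primality using (Prime; prime⇒nonZero)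
open import Data.Nat.Properties as ℕ using (m*n≢0)
import Data.Nat.Solver as ℕSolver
open import Data.Product.Base using (∃; ∃₂; Σ-syntax; _×_; _,_; proj₁; proj₂)
open import Data.Rational.Base as ℚ using (ℚ)
import Data.Rational.Properties as ℚ
import Data.Rational.Unnormalised.Base as ℚᵘ
import Data.Rational.Unnormalised.Properties as ℚᵘ
open import Data.Vec.Base as Vec using (Vec; []; _∷_; replicate)
open import Data.Vec.Relation.Unary.All as VecAll using ([]; _∷_)
open import Function.Base using (_∘_)
open import Level using (Level; _⊔_)
open import Relation.Binary.PropositionalEquality as ≡ using (_≡_)
import Relation.Binary.Reasoning.Setoid as ≈-Reasoning
open import Relation.Nullary.Decidable.Core using (yes; no; dec⇒maybe)
open import Relation.Nullary.Negation.Core using (contradiction)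

-- Two kinds of division shape the proof. In the residue ring neither p nor 1 - q is a unit, so
-- denominators are cleared and nonzero divisors cancelled: residues are compared after
-- multiplication by a positive integer, which makes p a nonzero divisor at once, and 1 - q inherits
-- this from p because [p] ≡ p modulo 1 - q. Primality acts through Bézout relations, which give the
-- inverses of [k]. Comparing coefficients likewise has to work over a ring with no given domain
-- property: at β = 0 the series α becomes 1 and (1 - α)² = β² becomes 0, which isolates one
-- coefficient, and multiplication by β is a mere shift, which allows cancelling. The constant -(1 -
-- q)² links the product to the sum: with y = qᵏ it satisfies (-y)(-(1 - q)²) = (y / [k]²)(1 - y)².
-- The square p² is ∏ (1 - qᵏ)², itself the coefficient t = 0 of the same comparison. One p cancels
-- against the p in (t + 1) ℓ = p C(p + t, 2t + 1), where ℓ is the Lucas coefficient of index t + 1;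
-- the other stays in the denominator.

-- Ring solver with integer coefficients

module IntegerSolver {c ℓ : Level} (R : CommutativeRing c ℓ) where
  open CommutativeRing R
  open RingProperties ring
    using (-‿distribˡ-*; -‿distribʳ-*; -‿+-comm; -‿involutive; -0#≈0#)
  open OptimisedMultiples semiring using (×-homo-+; ×1-homo-*) renaming (_×_ to _·_)
  open ≈-Reasoning setoid

  -- Equality in `R` need not be decidable, so the solver takes its coefficients from ℤ. The
  -- optimised multiples send 0 and 1 to `0#` and `1#` by reduction, so solved equations apply
  -- directly to terms containing these.
  fromℤ : ℤ → Carrier
  fromℤ (+ n)    = n · 1#
  fromℤ -[1+ n ] = - (suc n · 1#)

  fromℤ-neg : ∀ i → fromℤ (ℤ.- i) ≈ - fromℤ i
  fromℤ-neg (+ zero)  = sym -0#≈0#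
  fromℤ-neg (+ suc n) = refl
  fromℤ-neg -[1+ n ]  = sym (-‿involutive _)

  fromℤ-⊖ : ∀ m n → fromℤ (m ℤ.⊖ n) ≈ m · 1# - n · 1#
  fromℤ-⊖ m zero = begin
    m · 1#         ≈⟨ +-identityʳ _ ⟨
    m · 1# + 0#    ≈⟨ +-congˡ -0#≈0# ⟨
    m · 1# - 0#    ∎
  fromℤ-⊖ zero    (suc n) = sym (+-identityˡ _)
  fromℤ-⊖ (suc m) (suc n) = begin
    fromℤ (suc m ℤ.⊖ suc n)            ≡⟨ ≡.cong fromℤ (ℤ.[1+m]⊖[1+n]≡m⊖n m n) ⟩
    fromℤ (m ℤ.⊖ n)                    ≈⟨ fromℤ-⊖ m n ⟩
    m · 1# - n · 1#                    ≈⟨ +-congʳ (+-identityˡ _) ⟨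
    0# + m · 1# - n · 1#               ≈⟨ +-congʳ (+-congʳ (-‿inverseʳ 1#)) ⟨
    1# - 1# + m · 1# - n · 1#          ≈⟨ +-congʳ (+-assoc 1# (- 1#) (m · 1#)) ⟩
    1# + (- 1# + m · 1#) - n · 1#      ≈⟨ +-congʳ (+-congˡ (+-comm (- 1#) (m · 1#))) ⟩
    1# + (m · 1# - 1#) - n · 1#        ≈⟨ +-congʳ (+-assoc 1# (m · 1#) (- 1#)) ⟨
    1# + m · 1# - 1# - n · 1#          ≈⟨ +-assoc _ (- 1#) (- (n · 1#)) ⟩
    1# + m · 1# + (- 1# - n · 1#)      ≈⟨ +-congˡ (-‿+-comm 1# (n · 1#)) ⟩
    1# + m · 1# - (1# + n · 1#)        ≈⟨ +-cong (×-homo-+ 1# 1 m) (-‿cong (×-homo-+ 1# 1 n)) ⟨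
    suc m · 1# - suc n · 1#            ∎

  fromℤ-+ : ∀ i j → fromℤ (i ℤ.+ j) ≈ fromℤ i + fromℤ j
  fromℤ-+ (+ m)    (+ n)    = ×-homo-+ 1# m n
  fromℤ-+ (+ m)    -[1+ n ] = fromℤ-⊖ m (suc n)
  fromℤ-+ -[1+ m ] (+ n)    = trans (fromℤ-⊖ n (suc m)) (+-comm _ _)
  fromℤ-+ -[1+ m ] -[1+ n ] = begin
    - (suc (suc (m ℕ.+ n)) · 1#)       ≡⟨ ≡.cong (λ k → - (k · 1#)) (≡.cong suc (ℕ.+-suc m n)) ⟨
    - ((suc m ℕ.+ suc n) · 1#)         ≈⟨ -‿cong (×-homo-+ 1# (suc m) (suc n)) ⟩
    - (suc m · 1# + suc n · 1#)        ≈⟨ -‿+-comm _ _ ⟨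
    - (suc m · 1#) - suc n · 1#        ∎

  fromℤ-+* : ∀ m j → fromℤ (+ m ℤ.* j) ≈ m · 1# * fromℤ j
  fromℤ-+* m (+ n) = begin
    fromℤ (+ m ℤ.* + n)     ≡⟨ ≡.cong fromℤ (ℤ.pos-* m n) ⟨
    (m ℕ.* n) · 1#          ≈⟨ ×1-homo-* m n ⟩
    m · 1# * n · 1#         ∎
  fromℤ-+* m -[1+ n ] = begin
    fromℤ (+ m ℤ.* -[1+ n ])          ≡⟨ ≡.cong fromℤ (ℤ.neg-distribʳ-* (+ m) (+ suc n)) ⟨
    fromℤ (ℤ.- (+ m ℤ.* + suc n))     ≈⟨ fromℤ-neg (+ m ℤ.* + suc n) ⟩
    - fromℤ (+ m ℤ.* + suc n)         ≈⟨ -‿cong (fromℤ-+* m (+ suc n)) ⟩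
    - (m · 1# * suc n · 1#)           ≈⟨ -‿distribʳ-* _ _ ⟩
    m · 1# * - (suc n · 1#)           ∎

  fromℤ-* : ∀ i j → fromℤ (i ℤ.* j) ≈ fromℤ i * fromℤ j
  fromℤ-* (+ m)    j = fromℤ-+* m j
  fromℤ-* -[1+ m ] j = begin
    fromℤ (-[1+ m ] ℤ.* j)            ≡⟨ ≡.cong fromℤ (ℤ.neg-distribˡ-* (+ suc m) j) ⟨
    fromℤ (ℤ.- (+ suc m ℤ.* j))       ≈⟨ fromℤ-neg (+ suc m ℤ.* j) ⟩
    - fromℤ (+ suc m ℤ.* j)           ≈⟨ -‿cong (fromℤ-+* (suc m) j) ⟩
    - (suc m · 1# * fromℤ j)          ≈⟨ -‿distribˡ-* _ _ ⟩
    - (suc m · 1#) * fromℤ j          ∎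

  homomorphism : ℤ.+-*-rawRing -Raw-AlmostCommutative⟶ fromCommutativeRing R
  homomorphism = record
    { ⟦_⟧    = fromℤ
    ; +-homo = fromℤ-+
    ; *-homo = fromℤ-*
    ; -‿homo = fromℤ-neg
    ; 0-homo = refl
    ; 1-homo = refl
    }

  open RingSolver ℤ.+-*-rawRing (fromCommutativeRing R) homomorphism
    (λ i j → Maybe.map (λ i≡j → reflexive (≡.cong fromℤ i≡j)) (dec⇒maybe (i ℤ.≟ j)))
    public using (Polynomial; solve; _:=_; _:+_; _:*_; _:-_; :-_; con)

-- Formal power series

module PowerSeries {c ℓ : Level} (R : CommutativeRing c ℓ) where
  private
    module R = CommutativeRing R
    open R using (Carrier; _≈_; _+_; _*_; -_; 0#; 1#)
    open IntegerSolver R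
    open ≈-Reasoning R.setoid

  -- The Cauchy product through f = f₀ + X (f ∘ suc), which replaces finite sums by recursion on the
  -- index.
  conv : (ℕ → Carrier) → (ℕ → Carrier) → ℕ → Carrier
  conv f g zero    = f zero * g zero
  conv f g (suc n) = f zero * g (suc n) + conv (f ∘ suc) g n

  constant : Carrier → ℕ → Carrier
  constant a zero    = a
  constant a (suc n) = 0#

  conv-cong : ∀ {f f′ g g′} → (∀ n → f n ≈ f′ n) → (∀ n → g n ≈ g′ n) →
              ∀ n → conv f g n ≈ conv f′ g′ n
  conv-cong f≈f′ g≈g′ zero    = R.*-cong (f≈f′ 0) (g≈g′ 0)
  conv-cong f≈f′ g≈g′ (suc n) =
    R.+-cong (R.*-cong (f≈f′ 0) (g≈g′ (suc n))) (conv-cong (f≈f′ ∘ suc) g≈g′ n)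

  conv-zeroˡ : ∀ g n → conv (λ _ → 0#) g n ≈ 0#
  conv-zeroˡ g zero    = R.zeroˡ _
  conv-zeroˡ g (suc n) =
    R.trans (R.+-cong (R.zeroˡ _) (conv-zeroˡ g n)) (R.+-identityˡ 0#)

  conv-constantˡ : ∀ a g n → conv (constant a) g n ≈ a * g n
  conv-constantˡ a g zero    = R.refl
  conv-constantˡ a g (suc n) = R.trans (R.+-congˡ (conv-zeroˡ g n)) (R.+-identityʳ _)

  conv-distribʳ : ∀ h f g n → conv (λ k → f k + g k) h n ≈ conv f h n + conv g h n
  conv-distribʳ h f g zero    = R.distribʳ _ _ _
  conv-distribʳ h f g (suc n) = begin
    (f 0 + g 0) * h (suc n) + conv (λ k → f (suc k) + g (suc k)) h n
      ≈⟨ R.+-congˡ (conv-distribʳ h (f ∘ suc) (g ∘ suc) n) ⟩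
    (f 0 + g 0) * h (suc n) + (conv (f ∘ suc) h n + conv (g ∘ suc) h n)
      ≈⟨ solve 5 (λ f g h x y → (f :+ g) :* h :+ (x :+ y) := f :* h :+ x :+ (g :* h :+ y))
               R.refl (f 0) (g 0) (h (suc n)) (conv (f ∘ suc) h n) (conv (g ∘ suc) h n) ⟩
    f 0 * h (suc n) + conv (f ∘ suc) h n + (g 0 * h (suc n) + conv (g ∘ suc) h n) ∎

  conv-scaleˡ : ∀ a f g n → conv (λ k → a * f k) g n ≈ a * conv f g n
  conv-scaleˡ a f g zero    = R.*-assoc _ _ _
  conv-scaleˡ a f g (suc n) = begin
    a * f 0 * g (suc n) + conv (λ k → a * f (suc k)) g n
      ≈⟨ R.+-cong (R.*-assoc _ _ _) (conv-scaleˡ a (f ∘ suc) g n) ⟩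
    a * (f 0 * g (suc n)) + a * conv (f ∘ suc) g n
      ≈⟨ R.distribˡ _ _ _ ⟨
    a * (f 0 * g (suc n) + conv (f ∘ suc) g n) ∎

  -- The definition peels the left factor; peeling the right one instead is the step that
  -- commutativity requires.
  conv-suc : ∀ f g n → conv f g (suc n) ≈ g zero * f (suc n) + conv f (g ∘ suc) n
  conv-suc f g zero    =
    solve 4 (λ a b c d → a :* b :+ c :* d := d :* c :+ a :* b)
      R.refl (f 0) (g 1) (f 1) (g 0)
  conv-suc f g (suc n) = begin
    f 0 * g (suc (suc n)) + conv (f ∘ suc) g (suc n)
      ≈⟨ R.+-congˡ (conv-suc (f ∘ suc) g n) ⟩
    f 0 * g (suc (suc n)) + (g 0 * f (suc (suc n)) + conv (f ∘ suc) (g ∘ suc) n)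
      ≈⟨ solve 3 (λ a b c → a :+ (b :+ c) := b :+ (a :+ c)) R.refl _ _ _ ⟩
    g 0 * f (suc (suc n)) + (f 0 * g (suc (suc n)) + conv (f ∘ suc) (g ∘ suc) n) ∎

  conv-comm : ∀ f g n → conv f g n ≈ conv g f n
  conv-comm f g zero    = R.*-comm _ _
  conv-comm f g (suc n) =
    R.trans (R.+-congˡ (conv-comm (f ∘ suc) g n)) (R.sym (conv-suc g f n))

  conv-assoc : ∀ f g h n → conv (conv f g) h n ≈ conv f (conv g h) n
  conv-assoc f g h zero    = R.*-assoc _ _ _
  conv-assoc f g h (suc n) = begin
    f 0 * g 0 * h (suc n) + conv (λ k → f 0 * g (suc k) + conv (f ∘ suc) g k) h n
      ≈⟨ R.+-congˡ (conv-distribʳ h (λ k → f 0 * g (suc k)) (conv (f ∘ suc) g) n) ⟩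
    f 0 * g 0 * h (suc n) + (conv (λ k → f 0 * g (suc k)) h n + conv (conv (f ∘ suc) g) h n)
      ≈⟨ R.+-congˡ (R.+-cong (conv-scaleˡ (f 0) (g ∘ suc) h n) (conv-assoc (f ∘ suc) g h n)) ⟩
    f 0 * g 0 * h (suc n) + (f 0 * conv (g ∘ suc) h n + conv (f ∘ suc) (conv g h) n)
      ≈⟨ solve 5 (λ a b c d e → a :* b :* c :+ (a :* d :+ e) := a :* (b :* c :+ d) :+ e)
               R.refl (f 0) (g 0) (h (suc n)) (conv (g ∘ suc) h n) _ ⟩
    f 0 * (g 0 * h (suc n) + conv (g ∘ suc) h n) + conv (f ∘ suc) (conv g h) n ∎

  rawRing : RawRing c ℓ
  rawRing = record
    { Carrier = ℕ → Carrier
    ; _≈_     = λ f g → ∀ n → f n ≈ g n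
    ; _+_     = λ f g n → f n + g n
    ; _*_     = conv
    ; -_      = λ f n → - f n
    ; 0#      = λ _ → 0#
    ; 1#      = constant 1#
    }

  commutativeRing : CommutativeRing c ℓ
  commutativeRing = record
    { RawRing rawRing
    ; isCommutativeRing = record
      { isRing = record
        { +-isAbelianGroup = record
          { isGroup = record
            { isMonoid = record
              { isSemigroup = record
                { isMagma = record
                  { isEquivalence = record
                    { refl  = λ _ → R.refl
                    ; sym   = λ f≈g n → R.sym (f≈g n)
                    ; trans = λ f≈g g≈h n → R.trans (f≈g n) (g≈h n)
                    }
                  ; ∙-cong = λ f≈f′ g≈g′ n → R.+-cong (f≈f′ n) (g≈g′ n)
                  }
                ; assoc = λ f g h n → R.+-assoc (f n) (g n) (h n)
                }
              ; identity = (λ f n → R.+-identityˡ (f n)) , (λ f n → R.+-identityʳ (f n))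
              }
            ; inverse = (λ f n → R.-‿inverseˡ (f n)) , (λ f n → R.-‿inverseʳ (f n))
            ; ⁻¹-cong = λ f≈g n → R.-‿cong (f≈g n)
            }
          ; comm = λ f g n → R.+-comm (f n) (g n)
          }
        ; *-cong = conv-cong
        ; *-assoc = conv-assoc
        ; *-identity =
            (λ f n → R.trans (conv-constantˡ 1# f n) (R.*-identityˡ (f n))) ,
            (λ f n → R.trans (conv-comm f (constant 1#) n)
                             (R.trans (conv-constantˡ 1# f n) (R.*-identityˡ (f n))))
        ; distrib =
            (λ f g h n → R.trans (conv-comm f (λ k → g k + h k) n)
              (R.trans (conv-distribʳ f g h n) (R.+-cong (conv-comm g f n) (conv-comm h f n)))) ,
            conv-distribʳ
        }
      ; *-comm = conv-comm
      }
    }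

  constant-isRingHomomorphism : IsRingHomomorphism R.rawRing rawRing constant
  constant-isRingHomomorphism = record
    { isSemiringHomomorphism = record
      { isNearSemiringHomomorphism = record
        { +-isMonoidHomomorphism = record
          { isMagmaHomomorphism = record
            { isRelHomomorphism = record
              { cong = λ { a≈b zero → a≈b ; a≈b (suc n) → R.refl } }
            ; homo = λ { a b zero → R.refl ; a b (suc n) → R.sym (R.+-identityˡ 0#) }
            }
          ; ε-homo = λ { zero → R.refl ; (suc n) → R.refl }
          }
        ; *-homo = λ
          { a b zero    → R.refl
          ; a b (suc n) → R.sym (R.trans (conv-constantˡ a (constant b) (suc n)) (R.zeroʳ a))
          }
        }
      ; 1#-homo = λ _ → R.refl
      }
    ; -‿homo = λ
      { a zero    → R.refl
      ; a (suc n) → solve 0 (con 0ℤ := :- con 0ℤ) R.refl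
      }
    }

  var : ℕ → Carrier
  var zero    = 0#
  var (suc n) = constant 1# n

  -- Multiplication by the indeterminate shifts the index, hence is injective; `z-cancel` rests on
  -- this.
  conv-var-suc : ∀ f n → conv var f (suc n) ≈ f n
  conv-var-suc f n = begin
    0# * f (suc n) + conv (constant 1#) f n  ≈⟨ R.+-cong (R.zeroˡ _) (conv-constantˡ 1# f n) ⟩
    0# + 1# * f n                            ≈⟨ R.trans (R.+-identityˡ _) (R.*-identityˡ _) ⟩
    f n                                      ∎

-- Binomial identities and Lucas coefficients

-- Pascal's recursion, so that no division appears when reducing.

binomial : ℕ → ℕ → ℕ
binomial n       zero    = 1
binomial zero    (suc k) = 0
binomial (suc n) (suc k) = binomial n k ℕ.+ binomial n (suc k)

binomial≡C : ∀ n k → binomial n k ≡ n C k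
binomial≡C n       zero    = ≡.refl
binomial≡C zero    (suc k) = ≡.refl
binomial≡C (suc n) (suc k) =
  ≡.trans (≡.cong₂ ℕ._+_ (binomial≡C n k) (binomial≡C n (suc k))) (nCk+nC[k+1]≡[n+1]C[k+1] n k)

n<k⇒binomial≡0 : ∀ {n k} → n < k → binomial n k ≡ 0
n<k⇒binomial≡0 {n} {k} n<k = ≡.trans (binomial≡C n k) (k>n⇒nCk≡0 n<k)

-- This is (k + 1) C(n, k + 1) = (n - k) C(n, k) with the subtraction moved across, so that it also
-- covers k > n.
binomial-absorption : ∀ n k →
  suc k ℕ.* binomial n (suc k) ℕ.+ k ℕ.* binomial n k ≡ n ℕ.* binomial n k
binomial-absorption zero    zero    = ≡.refl
binomial-absorption zero    (suc k) = ≡.cong₂ ℕ._+_ (ℕ.*-zeroʳ (suc (suc k))) (ℕ.*-zeroʳ (suc k))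
binomial-absorption (suc n) zero    = begin
  1 ℕ.* (1 ℕ.+ b) ℕ.+ 0     ≡⟨ solve 1 (λ b → con 1 :* (con 1 :+ b) :+ con 0 := con 1 :+ (con 1 :* b :+ con 0)) ≡.refl b ⟩
  1 ℕ.+ (1 ℕ.* b ℕ.+ 0)     ≡⟨ ≡.cong suc (binomial-absorption n zero) ⟩
  suc n ℕ.* 1               ∎
  where
  open ≡.≡-Reasoning
  open ℕSolver.+-*-Solver
  b = binomial n 1
binomial-absorption (suc n) (suc k) = begin
  suc (suc k) ℕ.* (b ℕ.+ c) ℕ.+ suc k ℕ.* (a ℕ.+ b)
    ≡⟨ solve 4 (λ k a b c →
         (con 2 :+ k) :* (b :+ c) :+ (con 1 :+ k) :* (a :+ b) :=
         (con 2 :+ k) :* c :+ (con 1 :+ k) :* b :+ ((con 1 :+ k) :* b :+ k :* a) :+ (a :+ b))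
       ≡.refl k a b c ⟩
  suc (suc k) ℕ.* c ℕ.+ suc k ℕ.* b ℕ.+ (suc k ℕ.* b ℕ.+ k ℕ.* a) ℕ.+ (a ℕ.+ b)
    ≡⟨ ≡.cong (ℕ._+ (a ℕ.+ b)) (≡.cong₂ ℕ._+_ (binomial-absorption n (suc k)) (binomial-absorption n k)) ⟩
  n ℕ.* b ℕ.+ n ℕ.* a ℕ.+ (a ℕ.+ b)
    ≡⟨ solve 3 (λ n a b → n :* b :+ n :* a :+ (a :+ b) := (con 1 :+ n) :* (a :+ b)) ≡.refl n a b ⟩
  suc n ℕ.* (a ℕ.+ b) ∎
  where
  open ≡.≡-Reasoning
  open ℕSolver.+-*-Solver
  a = binomial n k
  b = binomial n (suc k)
  c = binomial n (suc (suc k))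

-- The coefficient of xᵗ in the Morgan-Voyce polynomial bₙ(x), for which bₙ₊₂ + bₙ = (2 + x) bₙ₊₁.
morgan : ℕ → ℕ → ℕ
morgan n t = binomial (n ℕ.+ t) (t ℕ.+ t)

morgan-rec : ∀ n t →
  morgan (suc (suc n)) (suc t) ℕ.+ morgan n (suc t) ≡
  2 ℕ.* morgan (suc n) (suc t) ℕ.+ morgan (suc n) t
morgan-rec n t rewrite ℕ.+-suc t t | ℕ.+-suc n t =
  -- By reduction, Pascal's rule expresses everything in row n + t + 1, through the entries at 2t,
  -- 2t + 1 and 2t + 2.
  solve 3 (λ a b c → a :+ b :+ (b :+ c) :+ c := con 2 :* (b :+ c) :+ a) ≡.refl
    (binomial (suc (n ℕ.+ t)) (t ℕ.+ t))
    (binomial (suc (n ℕ.+ t)) (suc (t ℕ.+ t)))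
    (binomial (suc (n ℕ.+ t)) (suc (suc (t ℕ.+ t))))
  where open ℕSolver.+-*-Solver

n<t⇒morgan≡0 : ∀ {n t} → n < t → morgan n t ≡ 0
n<t⇒morgan≡0 {n} {t} n<t = n<k⇒binomial≡0 (ℕ.+-monoˡ-< t n<t)

-- The coefficients of αⁿ⁺¹ + α⁻⁽ⁿ⁺¹⁾ as a polynomial in (1 - α)² / α.

lucas : ℕ → ℕ → ℕ
lucas n t = morgan (suc n) t ℕ.+ morgan n t

lucas-rec : ∀ n t →
  lucas (suc (suc n)) (suc t) ℕ.+ lucas n (suc t) ≡
  2 ℕ.* lucas (suc n) (suc t) ℕ.+ lucas (suc n) t
lucas-rec n t = begin
  a ℕ.+ b ℕ.+ (b′ ℕ.+ c)
    ≡⟨ solve 4 (λ a b b′ c → a :+ b :+ (b′ :+ c) := a :+ b′ :+ (b :+ c)) ≡.refl a b b′ c ⟩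
  a ℕ.+ b′ ℕ.+ (b ℕ.+ c)
    ≡⟨ ≡.cong₂ ℕ._+_ (morgan-rec (suc n) t) (morgan-rec n t) ⟩
  2 ℕ.* b ℕ.+ d ℕ.+ (2 ℕ.* b′ ℕ.+ e)
    ≡⟨ solve 4 (λ b d b′ e → con 2 :* b :+ d :+ (con 2 :* b′ :+ e) := con 2 :* (b :+ b′) :+ (d :+ e))
         ≡.refl b d b′ e ⟩
  2 ℕ.* (b ℕ.+ b′) ℕ.+ (d ℕ.+ e) ∎
  where
  open ≡.≡-Reasoning
  open ℕSolver.+-*-Solver
  a = morgan (3 ℕ.+ n) (suc t)
  b = morgan (2 ℕ.+ n) (suc t)
  b′ = morgan (1 ℕ.+ n) (suc t)
  c = morgan n (suc t)
  d = morgan (2 ℕ.+ n) t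
  e = morgan (1 ℕ.+ n) t

1+n<t⇒lucas≡0 : ∀ {n t} → suc n < t → lucas n t ≡ 0
1+n<t⇒lucas≡0 {n} n<t =
  ≡.cong₂ ℕ._+_ (n<t⇒morgan≡0 n<t) (n<t⇒morgan≡0 (ℕ.<-trans (ℕ.n<1+n n) n<t))

-- Pascal's rule gives `lucas n (suc t)` as x + 2y, and absorption trades (2t + 2) y for (n - t) x.
-- Adding (2t + 1) x to both sides avoids that subtraction.
lucas-closed : ∀ n t →
  suc t ℕ.* lucas n (suc t) ≡ suc n ℕ.* binomial (suc n ℕ.+ t) (2 ℕ.* t ℕ.+ 1)
lucas-closed n t rewrite ℕ.+-suc t t | ℕ.+-suc n t | ℕ.+-comm (2 ℕ.* t) 1 | ℕ.+-identityʳ t =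
  ℕ.+-cancelʳ-≡ (suc (t ℕ.+ t) ℕ.* x) _ _ (begin
    suc t ℕ.* (x ℕ.+ y ℕ.+ y) ℕ.+ suc (t ℕ.+ t) ℕ.* x
      ≡⟨ solve 3 (λ t x y →
           (con 1 :+ t) :* (x :+ y :+ y) :+ (con 1 :+ (t :+ t)) :* x :=
           (con 2 :+ (t :+ t)) :* y :+ (con 1 :+ (t :+ t)) :* x :+ (con 1 :+ t) :* x)
         ≡.refl t x y ⟩
    suc (suc (t ℕ.+ t)) ℕ.* y ℕ.+ suc (t ℕ.+ t) ℕ.* x ℕ.+ suc t ℕ.* x
      ≡⟨ ≡.cong (ℕ._+ suc t ℕ.* x) (binomial-absorption (suc (n ℕ.+ t)) (suc (t ℕ.+ t))) ⟩
    suc (n ℕ.+ t) ℕ.* x ℕ.+ suc t ℕ.* x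
      ≡⟨ solve 3 (λ n t x →
           (con 1 :+ (n :+ t)) :* x :+ (con 1 :+ t) :* x :=
           (con 1 :+ n) :* x :+ (con 1 :+ (t :+ t)) :* x)
         ≡.refl n t x ⟩
    suc n ℕ.* x ℕ.+ suc (t ℕ.+ t) ℕ.* x ∎)
  where
  open ≡.≡-Reasoning
  open ℕSolver.+-*-Solver
  x = binomial (suc (n ℕ.+ t)) (suc (t ℕ.+ t))
  y = binomial (suc (n ℕ.+ t)) (suc (suc (t ℕ.+ t)))

-- Binary forms and products of linear forms

module FormCoefficients {c ℓ : Level} (S : CommutativeRing c ℓ) where
  open CommutativeRing S hiding (zero)
  open IntegerSolver S
  open ≈-Reasoning setoid

  mulLinear : Carrier → Carrier → (ℕ → Carrier) → ℕ → Carrier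
  mulLinear a b f zero    = a * f zero
  mulLinear a b f (suc t) = a * f (suc t) + b * f t

  -- The coefficient of Bᵗ Aᵐ⁻ᵗ in the product of the linear forms a j A + b j B, j < m.

  coefficients : (ℕ → Carrier) → (ℕ → Carrier) → ℕ → ℕ → Carrier
  coefficients a b zero    zero    = 1#
  coefficients a b zero    (suc t) = 0#
  coefficients a b (suc m) = mulLinear (a 0) (b 0) (coefficients (a ∘ suc) (b ∘ suc) m)

  coefficients-vanish : ∀ a b {m t} → m < t → coefficients a b m t ≈ 0#
  coefficients-vanish a b {zero}  {suc t} _         = refl
  coefficients-vanish a b {suc m} {suc t} (s≤s m<t) = begin
    a 0 * f (suc t) + b 0 * f t  ≈⟨ +-cong (*-congˡ (coefficients-vanish _ _ (ℕ.m<n⇒m<1+n m<t)))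
                                           (*-congˡ (coefficients-vanish _ _ m<t)) ⟩
    a 0 * 0# + b 0 * 0#          ≈⟨ solve 2 (λ a b → a :* con 0ℤ :+ b :* con 0ℤ := con 0ℤ) refl (a 0) (b 0) ⟩
    0#                           ∎
    where f = coefficients (a ∘ suc) (b ∘ suc) m

  ∏ : ℕ → (ℕ → Carrier) → Carrier
  ∏ zero    g = 1#
  ∏ (suc m) g = g 0 * ∏ m (g ∘ suc)

  ∏-cong : ∀ m {g h} → (∀ j → g j ≈ h j) → ∏ m g ≈ ∏ m h
  ∏-cong zero    g≈h = refl
  ∏-cong (suc m) g≈h = *-cong (g≈h 0) (∏-cong m (g≈h ∘ suc))

  ∏-* : ∀ m g h → ∏ m g * ∏ m h ≈ ∏ m (λ j → g j * h j)
  ∏-* zero    g h = *-identityˡ 1#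
  ∏-* (suc m) g h = begin
    g 0 * ∏ m (g ∘ suc) * (h 0 * ∏ m (h ∘ suc))
      ≈⟨ solve 4 (λ a b c d → a :* b :* (c :* d) := a :* c :* (b :* d)) refl _ _ _ _ ⟩
    g 0 * h 0 * (∏ m (g ∘ suc) * ∏ m (h ∘ suc))
      ≈⟨ *-congˡ (∏-* m (g ∘ suc) (h ∘ suc)) ⟩
    g 0 * h 0 * ∏ m (λ j → g (suc j) * h (suc j)) ∎

module Forms {c ℓ : Level} (S T : CommutativeRing c ℓ)
  (φ : CommutativeRing.Carrier S → CommutativeRing.Carrier T)
  (φ-hom : IsRingHomomorphism (CommutativeRing.rawRing S) (CommutativeRing.rawRing T) φ)
  where
  private module S = CommutativeRing S
  open CommutativeRing T hiding (zero)
  open IsRingHomomorphism φ-hom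
    using (+-homo; *-homo; 0#-homo; 1#-homo) renaming (⟦⟧-cong to φ-cong)
  open IntegerSolver T
  open Exponentiation semiring using (_^_)
  open Multiples S.semiring using ()
    renaming (_×_ to _·_; ×-homo-+ to ·-homo-+; ×1-homo-* to ·1-homo-*; ×-congˡ to ·-congˡ)
  open Multiples semiring using () renaming (_×_ to _·′_)
  open FormCoefficients S using (mulLinear; coefficients; coefficients-vanish)
  open FormCoefficients T using (∏)
  open ≈-Reasoning setoid

  module _ (x y : Carrier) where

    -- The binary form of degree `n` with coefficient `f t` at xⁿ⁻ᵗ yᵗ. Coefficients stay in `S`
    -- while x and y live in `T`, so that the coefficients can be recovered from the value once `T`
    -- is a power series ring over `S`.
    form : ℕ → (ℕ → S.Carrier) → Carrier
    form zero    f = φ (f 0)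
    form (suc n) f = x ^ suc n * φ (f 0) + y * form n (f ∘ suc)

    form-cong : ∀ n {f g} → (∀ t → t ≤ n → f t S.≈ g t) → form n f ≈ form n g
    form-cong zero    f≈g = φ-cong (f≈g 0 z≤n)
    form-cong (suc n) f≈g = +-cong
      (*-congˡ (φ-cong (f≈g 0 z≤n))) (*-congˡ (form-cong n λ t t≤n → f≈g (suc t) (s≤s t≤n)))

    form-+ : ∀ n f g → form n (λ t → f t S.+ g t) ≈ form n f + form n g
    form-+ zero    f g = +-homo _ _
    form-+ (suc n) f g = begin
      x ^ suc n * φ (f 0 S.+ g 0) + y * form n (λ t → f (suc t) S.+ g (suc t))
        ≈⟨ +-cong (*-congˡ (+-homo _ _)) (*-congˡ (form-+ n (f ∘ suc) (g ∘ suc))) ⟩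
      x ^ suc n * (φ (f 0) + φ (g 0)) + y * (form n (f ∘ suc) + form n (g ∘ suc))
        ≈⟨ solve 6 (λ p a b y u v → p :* (a :+ b) :+ y :* (u :+ v) := p :* a :+ y :* u :+ (p :* b :+ y :* v))
             refl _ _ _ _ _ _ ⟩
      x ^ suc n * φ (f 0) + y * form n (f ∘ suc) + (x ^ suc n * φ (g 0) + y * form n (g ∘ suc)) ∎

    form-scale : ∀ n a f → form n (λ t → a S.* f t) ≈ φ a * form n f
    form-scale zero    a f = *-homo _ _
    form-scale (suc n) a f = begin
      x ^ suc n * φ (a S.* f 0) + y * form n (λ t → a S.* f (suc t))
        ≈⟨ +-cong (*-congˡ (*-homo _ _)) (*-congˡ (form-scale n a (f ∘ suc))) ⟩
      x ^ suc n * (φ a * φ (f 0)) + y * (φ a * form n (f ∘ suc))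
        ≈⟨ solve 5 (λ p a b y u → p :* (a :* b) :+ y :* (a :* u) := a :* (p :* b :+ y :* u))
             refl _ _ _ _ _ ⟩
      φ a * (x ^ suc n * φ (f 0) + y * form n (f ∘ suc)) ∎

    -- Homogenisation: powers of x bring forms of different degrees to a common degree, where they
    -- can be added.
    form-extend : ∀ n f → f (suc n) S.≈ S.0# → form (suc n) f ≈ x * form n f
    form-extend zero f f₁≈0 = begin
      x ^ 1 * φ (f 0) + y * φ (f 1)  ≈⟨ +-congˡ (*-congˡ (trans (φ-cong f₁≈0) 0#-homo)) ⟩
      x * 1# * φ (f 0) + y * 0#
        ≈⟨ solve 3 (λ x a y → x :* con 1ℤ :* a :+ y :* con 0ℤ := x :* a) refl _ _ _ ⟩
      x * φ (f 0)                    ∎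
    form-extend (suc n) f f₂₊ₙ≈0 = begin
      x * x ^ suc n * φ (f 0) + y * form (suc n) (f ∘ suc)
        ≈⟨ +-congˡ (*-congˡ (form-extend n (f ∘ suc) f₂₊ₙ≈0)) ⟩
      x * x ^ suc n * φ (f 0) + y * (x * form n (f ∘ suc))
        ≈⟨ solve 5 (λ x p a y u → x :* p :* a :+ y :* (x :* u) := x :* (p :* a :+ y :* u))
             refl _ _ _ _ _ ⟩
      x * (x ^ suc n * φ (f 0) + y * form n (f ∘ suc)) ∎

    -- Since `f` is an infinite sequence, the top coefficient on the left contains a f(n + 1), which
    -- the form of degree n on the right cannot see; hence the vanishing hypothesis.
    form-mulLinear : ∀ n a b f → f (suc n) S.≈ S.0# →
      form (suc n) (mulLinear a b f) ≈ (x * φ a + y * φ b) * form n f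
    form-mulLinear n a b f f₁₊ₙ≈0 = begin
      x ^ suc n * φ (a S.* f 0) + y * form n (λ t → a S.* f (suc t) S.+ b S.* f t)
        ≈⟨ +-cong (*-congˡ (*-homo _ _)) (*-congˡ
             (trans (form-+ n (λ t → a S.* f (suc t)) (λ t → b S.* f t))
                    (+-cong (form-scale n a (f ∘ suc)) (form-scale n b f)))) ⟩
      x ^ suc n * (φ a * φ (f 0)) + y * (φ a * form n (f ∘ suc) + φ b * form n f)
        ≈⟨ solve 7 (λ p a f₀ y u b v → p :* (a :* f₀) :+ y :* (a :* u :+ b :* v) :=
                                       a :* (p :* f₀ :+ y :* u) :+ y :* b :* v)
             refl _ _ _ _ _ _ _ ⟩
      φ a * form (suc n) f + y * φ b * form n f
        ≈⟨ +-congʳ (*-congˡ (form-extend n f f₁₊ₙ≈0)) ⟩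
      φ a * (x * form n f) + y * φ b * form n f
        ≈⟨ solve 5 (λ a x v y b → a :* (x :* v) :+ y :* b :* v := (x :* a :+ y :* b) :* v)
             refl _ _ _ _ _ ⟩
      (x * φ a + y * φ b) * form n f ∎

    form-coefficients : ∀ m a b →
      form m (coefficients a b m) ≈ ∏ m (λ j → x * φ (a j) + y * φ (b j))
    form-coefficients zero    a b = 1#-homo
    form-coefficients (suc m) a b = begin
      form (suc m) (mulLinear (a 0) (b 0) (coefficients (a ∘ suc) (b ∘ suc) m))
        ≈⟨ form-mulLinear m (a 0) (b 0) _ (coefficients-vanish (a ∘ suc) (b ∘ suc) {m} ℕ.≤-refl) ⟩
      (x * φ (a 0) + y * φ (b 0)) * form m (coefficients (a ∘ suc) (b ∘ suc) m)
        ≈⟨ *-congˡ (form-coefficients m (a ∘ suc) (b ∘ suc)) ⟩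
      ∏ (suc m) (λ j → x * φ (a j) + y * φ (b j)) ∎

    form-geometric : ∀ n → (x - y) * form n (λ _ → S.1#) ≈ x ^ suc n - y ^ suc n
    form-geometric zero    = trans (*-congˡ 1#-homo)
      (solve 2 (λ x y → (x :- y) :* con 1ℤ := x :* con 1ℤ :- y :* con 1ℤ) refl x y)
    form-geometric (suc n) = begin
      (x - y) * (x ^ suc n * φ S.1# + y * form n (λ _ → S.1#))
        ≈⟨ *-congˡ (+-congʳ (*-congˡ 1#-homo)) ⟩
      (x - y) * (x ^ suc n * 1# + y * form n (λ _ → S.1#))
        ≈⟨ solve 4 (λ x y p u → (x :- y) :* (p :* con 1ℤ :+ y :* u) := (x :- y) :* p :+ y :* ((x :- y) :* u))
             refl x y _ _ ⟩
      (x - y) * x ^ suc n + y * ((x - y) * form n (λ _ → S.1#))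
        ≈⟨ +-congˡ (*-congˡ (form-geometric n)) ⟩
      (x - y) * x ^ suc n + y * (x ^ suc n - y ^ suc n)
        ≈⟨ solve 4 (λ x y p q → (x :- y) :* p :+ y :* (p :- q) := x :* p :- y :* q) refl x y _ _ ⟩
      x ^ suc (suc n) - y ^ suc (suc n) ∎

  fromℕ : ℕ → S.Carrier
  fromℕ n = n · S.1#

  φ-fromℕ : ∀ n → φ (fromℕ n) ≈ n ·′ 1#
  φ-fromℕ zero    = 0#-homo
  φ-fromℕ (suc n) = trans (+-homo _ _) (+-cong 1#-homo (φ-fromℕ n))

  module _ (α : Carrier) where
    private
      z : Carrier
      z = (1# - α) * (1# - α)

      L : ℕ → ℕ → Carrier
      L m n = form α z m (fromℕ ∘ lucas n)

    lucas-vanish : ∀ n t → suc n < t → fromℕ (lucas n t) S.≈ S.0#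
    lucas-vanish n t 1+n<t = ·-congˡ (1+n<t⇒lucas≡0 1+n<t)

    -- For Vₘ = αᵐ + α⁻ᵐ this is Vₘ₊₁ + Vₘ₋₁ = (α + α⁻¹) Vₘ at m = n + 2, cleared of denominators.
    -- The coefficientwise recursion has the linear factor 2α + (1 - α)², which equals 1 + α².
    form-lucas-rec : ∀ n →
      L (3 ℕ.+ n) (2 ℕ.+ n) + α * (α * L (1 ℕ.+ n) n) ≈ (1# + α * α) * L (2 ℕ.+ n) (1 ℕ.+ n)
    form-lucas-rec n = begin
      L (3 ℕ.+ n) (2 ℕ.+ n) + α * (α * L (1 ℕ.+ n) n)
        ≈⟨ +-congˡ (*-congˡ (form-extend α z (1 ℕ.+ n) (fromℕ ∘ lucas n) (lucas-vanish n (2 ℕ.+ n) ℕ.≤-refl))) ⟨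
      L (3 ℕ.+ n) (2 ℕ.+ n) + α * L (2 ℕ.+ n) n
        ≈⟨ +-congˡ (form-extend α z (2 ℕ.+ n) (fromℕ ∘ lucas n) (lucas-vanish n (3 ℕ.+ n) (ℕ.m<n⇒m<1+n ℕ.≤-refl))) ⟨
      L (3 ℕ.+ n) (2 ℕ.+ n) + L (3 ℕ.+ n) n
        ≈⟨ form-+ α z (3 ℕ.+ n) (fromℕ ∘ lucas (2 ℕ.+ n)) (fromℕ ∘ lucas n) ⟨
      form α z (3 ℕ.+ n) (λ t → fromℕ (lucas (2 ℕ.+ n) t) S.+ fromℕ (lucas n t))
        ≈⟨ form-cong α z (3 ℕ.+ n) {g = mulLinear (fromℕ 2) S.1# (fromℕ ∘ lucas (1 ℕ.+ n))} (λ t _ → coefficient t) ⟩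
      form α z (3 ℕ.+ n) (mulLinear (fromℕ 2) S.1# (fromℕ ∘ lucas (1 ℕ.+ n)))
        ≈⟨ form-mulLinear α z (2 ℕ.+ n) (fromℕ 2) S.1# (fromℕ ∘ lucas (1 ℕ.+ n)) (lucas-vanish (1 ℕ.+ n) (3 ℕ.+ n) ℕ.≤-refl) ⟩
      (α * φ (fromℕ 2) + z * φ S.1#) * L (2 ℕ.+ n) (1 ℕ.+ n)
        ≈⟨ *-congʳ (+-cong (*-congˡ (φ-fromℕ 2)) (*-congˡ 1#-homo)) ⟩
      (α * (1# + (1# + 0#)) + z * 1#) * L (2 ℕ.+ n) (1 ℕ.+ n)
        ≈⟨ *-congʳ (solve 1 (λ α → α :* (con 1ℤ :+ (con 1ℤ :+ con 0ℤ)) :+ (con 1ℤ :- α) :* (con 1ℤ :- α) :* con 1ℤ :=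
                                   con 1ℤ :+ α :* α) refl α) ⟩
      (1# + α * α) * L (2 ℕ.+ n) (1 ℕ.+ n) ∎
      where
      coefficient : ∀ t → fromℕ (lucas (2 ℕ.+ n) t) S.+ fromℕ (lucas n t) S.≈
                          mulLinear (fromℕ 2) S.1# (fromℕ ∘ lucas (1 ℕ.+ n)) t
      -- Every `lucas m 0` is 2, so at t = 0 the claim is 2 + 2 = 2 · 2.
      coefficient zero    = S.trans (S.sym (·-homo-+ S.1# 2 2)) (·1-homo-* 2 2)
      coefficient (suc t) = S.trans (S.sym (·-homo-+ S.1# (lucas (2 ℕ.+ n) (suc t)) (lucas n (suc t))))
        (S.trans (·-congˡ (lucas-rec n t))
        (S.trans (·-homo-+ S.1# (2 ℕ.* lucas (1 ℕ.+ n) (suc t)) (lucas (1 ℕ.+ n) t))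
                 (S.+-cong (·1-homo-* 2 (lucas (1 ℕ.+ n) (suc t))) (S.sym (S.*-identityˡ _)))))

    -- Divided by αⁿ⁺¹, this is the expansion of αⁿ⁺¹ + α⁻⁽ⁿ⁺¹⁾. The recursion has order two, hence
    -- the two base cases.
    form-lucas : ∀ n → L (suc n) n ≈ 1# + α ^ suc n * α ^ suc n
    form-lucas zero = begin
      α * 1# * φ (fromℕ 2) + z * φ (fromℕ 1)
        ≈⟨ +-cong (*-congˡ (φ-fromℕ 2)) (*-congˡ (φ-fromℕ 1)) ⟩
      α * 1# * (2 ·′ 1#) + z * (1 ·′ 1#)
        ≈⟨ solve 1 (λ α →
             α :* :1 :* (:1 :+ (:1 :+ :0)) :+ (:1 :- α) :* (:1 :- α) :* (:1 :+ :0) :=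
             :1 :+ α :* :1 :* (α :* :1)) refl α ⟩
      1# + α * 1# * (α * 1#) ∎
      where
      :0 :1 : ∀ {n} → Polynomial n
      :0 = con 0ℤ
      :1 = con 1ℤ
    form-lucas (suc zero) = begin
      -- The coefficients 2, 4, 1 are those of (x + 2)² - 2, that is, of α² + α⁻² with x = (1 - α)²
      -- / α.
      α * (α * 1#) * φ (fromℕ 2) + z * (α * 1# * φ (fromℕ 4) + z * φ (fromℕ 1))
        ≈⟨ +-cong (*-congˡ (φ-fromℕ 2))
             (*-congˡ (+-cong (*-congˡ (φ-fromℕ 4)) (*-congˡ (φ-fromℕ 1)))) ⟩
      α * (α * 1#) * (2 ·′ 1#) + z * (α * 1# * (4 ·′ 1#) + z * (1 ·′ 1#))
        ≈⟨ solve 1 (λ α →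
             α :* (α :* :1) :* (:1 :+ (:1 :+ :0)) :+
             (:1 :- α) :* (:1 :- α) :* (α :* :1 :* (:1 :+ (:1 :+ (:1 :+ (:1 :+ :0)))) :+
               (:1 :- α) :* (:1 :- α) :* (:1 :+ :0)) :=
             :1 :+ α :* (α :* :1) :* (α :* (α :* :1))) refl α ⟩
      1# + α * (α * 1#) * (α * (α * 1#)) ∎
      where
      :0 :1 : ∀ {n} → Polynomial n
      :0 = con 0ℤ
      :1 = con 1ℤ
    form-lucas (suc (suc n)) = begin
      v₂
        ≈⟨ solve 2 (λ v w → v := v :+ w :- w) refl v₂ (α * (α * v₀)) ⟩
      v₂ + α * (α * v₀) - α * (α * v₀)
        ≈⟨ +-cong (form-lucas-rec n) (-‿cong (*-congˡ (*-congˡ (form-lucas n)))) ⟩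
      (1# + α * α) * v₁ - α * (α * (1# + α ^ suc n * α ^ suc n))
        ≈⟨ +-congʳ (*-congˡ (form-lucas (suc n))) ⟩
      (1# + α * α) * (1# + α * α ^ suc n * (α * α ^ suc n)) - α * (α * (1# + α ^ suc n * α ^ suc n))
        ≈⟨ solve 2 (λ α u →
             (con 1ℤ :+ α :* α) :* (con 1ℤ :+ α :* u :* (α :* u)) :- α :* (α :* (con 1ℤ :+ u :* u)) :=
             con 1ℤ :+ α :* (α :* u) :* (α :* (α :* u))) refl α (α ^ suc n) ⟩
      1# + α ^ (3 ℕ.+ n) * α ^ (3 ℕ.+ n) ∎
      where
      v₀ = L (1 ℕ.+ n) n
      v₁ = L (2 ℕ.+ n) (1 ℕ.+ n)
      v₂ = L (3 ℕ.+ n) (2 ℕ.+ n)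

-- Comparing coefficients of forms in power series

module SeriesForms {c ℓ : Level} (S : CommutativeRing c ℓ) where
  private module S = CommutativeRing S
  open PowerSeries S using (conv; constant; var; conv-var-suc; constant-isRingHomomorphism)
    renaming (commutativeRing to S[[β]])
  open Forms S S[[β]] constant constant-isRingHomomorphism public
  open CommutativeRing S[[β]] hiding (zero)
  open Exponentiation semiring using (_^_)
  open ≈-Reasoning S.setoid

  α : ℕ → S.Carrier
  α = 1# - var

  α₀≈1 : α 0 S.≈ S.1#
  α₀≈1 = solve 0 (con 1ℤ :- con 0ℤ := con 1ℤ) S.refl
    where open IntegerSolver S

  α^n₀≈1 : ∀ n → (α ^ n) 0 S.≈ S.1#
  α^n₀≈1 zero    = S.refl
  α^n₀≈1 (suc n) = S.trans (S.*-cong α₀≈1 (α^n₀≈1 n)) (S.*-identityˡ S.1#)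

  z : ℕ → S.Carrier
  z = (1# - α) * (1# - α)

  z≈var² : z ≈ var * var
  z≈var² = solve 1 (λ v → let w = con 1ℤ :- (con 1ℤ :- v) in w :* w := v :* v) refl var
    where open IntegerSolver S[[β]]

  -- As z is β², the shift by β is undone twice.
  z-cancel : ∀ f g → z * f ≈ z * g → f ≈ g
  z-cancel f g zf≈zg = cancel f g (cancel (var * f) (var * g)
    (trans (expand f) (trans zf≈zg (sym (expand g)))))
    where
    expand : ∀ f → var * (var * f) ≈ z * f
    expand f = trans (sym (*-assoc var var f)) (*-congʳ {f} (sym z≈var²))
    cancel : ∀ f g → var * f ≈ var * g → f ≈ g
    cancel f g βf≈βg n =
      S.trans (S.sym (conv-var-suc f n)) (S.trans (βf≈βg (suc n)) (conv-var-suc g n))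

  -- The constant term of the value is `f 0`; removing the summand αⁿ `f 0` leaves z times a form of
  -- lower degree, so cancelling z allows induction.
  form-injective : ∀ n f g → form α z n f ≈ form α z n g → ∀ t → t ≤ n → f t S.≈ g t
  form-injective n f g eq zero z≤n =
    S.trans (S.sym (constantTerm n f)) (S.trans (eq 0) (constantTerm n g))
    where
    open IntegerSolver S
    constantTerm : ∀ n f → form α z n f 0 S.≈ f 0
    constantTerm zero    f = S.refl
    constantTerm (suc n) f = S.trans
      (S.+-cong (S.*-congʳ (α^n₀≈1 (suc n))) (S.*-congʳ (z≈var² 0)))
      (solve 2 (λ a u → con 1ℤ :* a :+ con 0ℤ :* con 0ℤ :* u := a) S.refl (f 0) (form α z n (f ∘ suc) 0))
  form-injective (suc n) f g eq (suc t) (s≤s t≤n) =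
    form-injective n (f ∘ suc) (g ∘ suc) (z-cancel _ _ tails) t t≤n
    where
    open RingProperties ring using (+-cancelˡ)
    open IsRingHomomorphism constant-isRingHomomorphism using () renaming (⟦⟧-cong to constant-cong)
    f₀≈g₀ : f 0 S.≈ g 0
    f₀≈g₀ = form-injective (suc n) f g eq 0 z≤n
    tails : z * form α z n (f ∘ suc) ≈ z * form α z n (g ∘ suc)
    tails = +-cancelˡ (α ^ suc n * constant (f 0)) _ _
      (trans eq (+-congʳ (*-congˡ {α ^ suc n} (constant-cong (S.sym f₀≈g₀)))))

-- Elementary symmetric functions at roots of unity

module EsymAtRootsOfUnity {c ℓ : Level} (S : CommutativeRing c ℓ) where
  open CommutativeRing S hiding (zero)
  open IntegerSolver S
  open Exponentiation semiring using (_^_)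
  open Multiples semiring using ()
    renaming (_×_ to _·_; ×1-homo-* to ·1-homo-*; ×-congˡ to ·-congˡ)
  open FormCoefficients S
  open ≈-Reasoning setoid
  open GroupProperties +-group using (x≈y⇒x∙y⁻¹≈ε; x∙y⁻¹≈ε⇒x≈y)

  esym : ℕ → List Carrier → Carrier
  esym zero    xs       = 1#
  esym (suc t) []       = 0#
  esym (suc t) (x ∷ xs) = x * esym t xs + esym (suc t) xs

  -- Replacing B by s B turns the factor aⱼ A + bⱼ B into aⱼ (A + xⱼ B), whose product has
  -- coefficients ∏ aⱼ · eₜ. Stating the relation as bⱼ s = xⱼ aⱼ avoids dividing by aⱼ.
  coefficients-esym : ∀ s a b x m → (∀ j → j < m → b j * s ≈ x j * a j) →
    ∀ t → coefficients a b m t * s ^ t ≈ ∏ m a * esym t (List.applyUpTo x m)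
  coefficients-esym s a b x zero    bs≈xa zero    = refl
  coefficients-esym s a b x zero    bs≈xa (suc t) = trans (zeroˡ _) (sym (zeroʳ _))
  coefficients-esym s a b x (suc m) bs≈xa zero    = begin
    a 0 * f 0 * 1#           ≈⟨ *-assoc _ _ _ ⟩
    a 0 * (f 0 * 1#)         ≈⟨ *-congˡ (coefficients-esym s (a ∘ suc) (b ∘ suc) (x ∘ suc) m
                                  (λ j j<m → bs≈xa (suc j) (s≤s j<m)) 0) ⟩
    a 0 * (∏ m (a ∘ suc) * 1#) ≈⟨ *-assoc _ _ _ ⟨
    a 0 * ∏ m (a ∘ suc) * 1# ∎
    where f = coefficients (a ∘ suc) (b ∘ suc) m
  coefficients-esym s a b x (suc m) bs≈xa (suc t) = begin
    (a 0 * f (suc t) + b 0 * f t) * (s * s ^ t)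
      ≈⟨ solve 6 (λ a u b v s p → (a :* u :+ b :* v) :* (s :* p) := a :* (u :* (s :* p)) :+ b :* s :* (v :* p))
           refl _ _ _ _ _ _ ⟩
    a 0 * (f (suc t) * s ^ suc t) + b 0 * s * (f t * s ^ t)
      ≈⟨ +-cong (*-congˡ (rec (suc t))) (*-cong (bs≈xa 0 (s≤s z≤n)) (rec t)) ⟩
    a 0 * (Π * e (suc t)) + x 0 * a 0 * (Π * e t)
      ≈⟨ solve 5 (λ a Π u x v → a :* (Π :* u) :+ x :* a :* (Π :* v) := a :* Π :* (x :* v :+ u))
           refl _ _ _ _ _ ⟩
    a 0 * Π * (x 0 * e t + e (suc t)) ∎
    where
    f = coefficients (a ∘ suc) (b ∘ suc) m
    Π = ∏ m (a ∘ suc)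
    e : ℕ → Carrier
    e t = esym t (List.applyUpTo (x ∘ suc) m)
    rec = coefficients-esym s (a ∘ suc) (b ∘ suc) (x ∘ suc) m (λ j j<m → bs≈xa (suc j) (s≤s j<m))

  module _ (q : Carrier) where

    -- The q-difference equation (1 - y₀X) F(qX) = (1 - yₘX) F(X) of F(X) = ∏ⱼ (1 - yⱼX).

    q-difference : ∀ (y : ℕ → Carrier) → (∀ j → y (suc j) ≈ q * y j) → ∀ m j →
      let g = coefficients (λ _ → 1#) (λ j → - y j) m in
      q ^ suc j * g (suc j) - y 0 * (q ^ j * g j) ≈ g (suc j) - y m * g j
    q-difference y y-suc zero zero =
      solve 2 (λ q y → q :* con 1ℤ :* con 0ℤ :- y :* (con 1ℤ :* con 1ℤ) := con 0ℤ :- y :* con 1ℤ) refl q (y 0)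
    q-difference y y-suc zero (suc j) =
      solve 3 (λ q p y → q :* (q :* p) :* con 0ℤ :- y :* (q :* p :* con 0ℤ) := con 0ℤ :- y :* con 0ℤ)
        refl q (q ^ j) (y 0)
    q-difference y y-suc (suc m) zero = begin
      q * 1# * (1# * f 1 + - y 0 * f 0) - y 0 * (1# * (1# * f 0))
        ≈⟨ solve 4 (λ q y u v →
             q :* con 1ℤ :* (con 1ℤ :* u :+ :- y :* v) :- y :* (con 1ℤ :* (con 1ℤ :* v)) :=
             q :* con 1ℤ :* u :- q :* y :* (con 1ℤ :* v) :- y :* v) refl q (y 0) (f 1) (f 0) ⟩
      q * 1# * f 1 - q * y 0 * (1# * f 0) - y 0 * f 0
        ≈⟨ +-congʳ (+-congˡ (-‿cong (*-congʳ (y-suc 0)))) ⟨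
      q * 1# * f 1 - y 1 * (1# * f 0) - y 0 * f 0
        ≈⟨ +-congʳ (q-difference (y ∘ suc) (y-suc ∘ suc) m 0) ⟩
      f 1 - y (suc m) * f 0 - y 0 * f 0
        ≈⟨ solve 4 (λ u v y z → u :- z :* v :- y :* v := con 1ℤ :* u :+ :- y :* v :- z :* (con 1ℤ :* v))
             refl (f 1) (f 0) (y 0) (y (suc m)) ⟩
      1# * f 1 + - y 0 * f 0 - y (suc m) * (1# * f 0) ∎
      where f = coefficients (λ _ → 1#) (λ j → - y (suc j)) m
    q-difference y y-suc (suc m) (suc j) = begin
      q * p * (1# * f (2 ℕ.+ j) + - y 0 * f (1 ℕ.+ j)) - y 0 * (p * (1# * f (1 ℕ.+ j) + - y 0 * f j))
        ≈⟨ solve 6 (λ q p′ y u v w →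
             let p = q :* p′ in
             q :* p :* (con 1ℤ :* u :+ :- y :* v) :- y :* (p :* (con 1ℤ :* v :+ :- y :* w)) :=
             q :* p :* u :- q :* y :* (p :* v) :- y :* (p :* v :- q :* y :* (p′ :* w)))
             refl q (q ^ j) (y 0) (f (2 ℕ.+ j)) (f (1 ℕ.+ j)) (f j) ⟩
      q * p * f (2 ℕ.+ j) - q * y 0 * (p * f (1 ℕ.+ j)) - y 0 * (p * f (1 ℕ.+ j) - q * y 0 * (q ^ j * f j))
        ≈⟨ +-cong (+-congˡ (-‿cong (*-congʳ (y-suc 0))))
                  (-‿cong (*-congˡ (+-congˡ (-‿cong (*-congʳ (y-suc 0)))))) ⟨
      q * p * f (2 ℕ.+ j) - y 1 * (p * f (1 ℕ.+ j)) - y 0 * (p * f (1 ℕ.+ j) - y 1 * (q ^ j * f j))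
        -- Write F = (1 - y₀X) G. The factor 1 - q y₀X of F(qX) is 1 - y₁X, exactly what the
        -- equation for G calls for; its instances at `suc j` and `j` combine with weights 1 and
        -- -y₀.
        ≈⟨ +-cong (rec (suc j)) (-‿cong (*-congˡ (rec j))) ⟩
      f (2 ℕ.+ j) - z * f (1 ℕ.+ j) - y 0 * (f (1 ℕ.+ j) - z * f j)
        ≈⟨ solve 5 (λ y z u v w →
             u :- z :* v :- y :* (v :- z :* w) :=
             con 1ℤ :* u :+ :- y :* v :- z :* (con 1ℤ :* v :+ :- y :* w))
             refl (y 0) z (f (2 ℕ.+ j)) (f (1 ℕ.+ j)) (f j) ⟩
      1# * f (2 ℕ.+ j) + - y 0 * f (1 ℕ.+ j) - z * (1# * f (1 ℕ.+ j) + - y 0 * f j) ∎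
      where
      f = coefficients (λ _ → 1#) (λ j → - y (suc j)) m
      p = q ^ suc j
      z = y (suc m)
      rec = q-difference (y ∘ suc) (y-suc ∘ suc) m

  coefficients-zero : ∀ b m → coefficients (λ _ → 1#) b m 0 ≈ 1#
  coefficients-zero b zero    = refl
  coefficients-zero b (suc m) = trans (*-identityˡ _) (coefficients-zero (b ∘ suc) m)

  NonZeroDivisor : Carrier → Set (c ⊔ ℓ)
  NonZeroDivisor a = ∀ b → a * b ≈ 0# → b ≈ 0#

  module _
    (q : Carrier) (n : ℕ) (qⁿ⁺¹≈1 : q ^ suc n ≈ 1#)
    (1-qʲ-regular : ∀ j → j < n → NonZeroDivisor (1# - q ^ suc j))
    (1+n-regular : NonZeroDivisor (suc n · 1#))
    where

    a b : ℕ → Carrier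
    a j = (1# - q ^ suc j) * (1# - q ^ suc j)
    b j = - (q ^ suc j)

    -- Here y₀ = q and yₙ = qⁿ⁺¹ = 1, so the q-difference equation collapses to (1 - qʲ⁺¹)(gⱼ₊₁ -
    -- gⱼ) = 0 and neighbouring coefficients agree.
    cyclotomic-coefficients : ∀ j → j ≤ n → coefficients (λ _ → 1#) b n j ≈ 1#
    cyclotomic-coefficients zero    _   = coefficients-zero b n
    cyclotomic-coefficients (suc j) j<n = trans
      (x∙y⁻¹≈ε⇒x≈y _ _ (1-qʲ-regular j j<n _ (begin
        (1# - q * p) * (g (suc j) - g j)
          ≈⟨ solve 4 (λ q p u v → (con 1ℤ :- q :* p) :* (u :- v) :=
               u :- con 1ℤ :* v :- (q :* p :* u :- q :* con 1ℤ :* (p :* v))) refl q p _ _ ⟩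
        g (suc j) - 1# * g j - (q * p * g (suc j) - q * 1# * (p * g j))
          ≈⟨ +-congʳ (+-congˡ (-‿cong (*-congʳ qⁿ⁺¹≈1))) ⟨
        g (suc j) - q ^ suc n * g j - (q * p * g (suc j) - q * 1# * (p * g j))
          ≈⟨ x≈y⇒x∙y⁻¹≈ε (sym (q-difference q (λ j → q ^ suc j) (λ _ → refl) n j)) ⟩
        0# ∎)))
      (cyclotomic-coefficients j (ℕ.<⇒≤ j<n))
      where
      p = q ^ j
      g = coefficients (λ _ → 1#) b n

    private
      open SeriesForms S
      open PowerSeries S using (constant; constant-isRingHomomorphism)
        renaming (commutativeRing to S[[β]])
      module T = CommutativeRing S[[β]]
      module TS = IntegerSolver S[[β]]
      module TE = Exponentiation T.semiring
      module TF = FormCoefficients S[[β]]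
      module φ = IsRingHomomorphism constant-isRingHomomorphism
      module ≈T = ≈-Reasoning T.setoid
      P : T.Carrier
      P = α TE.^ suc n
      -- The shift in `expected` drops the constant 2 of αᵖ + α⁻ᵖ and divides the rest by (1 - α)² /
      -- α.
      actual expected : ℕ → Carrier
      actual = coefficients a b n
      expected t = lucas n (suc t) · 1#

    form-cyclotomic : ∀ x y → TF.∏ n (λ j → x T.* constant 1# T.+ y T.* constant (b j)) T.≈ form x y n (λ _ → 1#)
    form-cyclotomic x y = T.trans (T.sym (form-coefficients x y n (λ _ → 1#) b))
      (form-cong x y n {coefficients (λ _ → 1#) b n} {λ _ → 1#} cyclotomic-coefficients)

    φa : ∀ j → constant (a j) T.≈ (T.1# T.+ constant (b j)) T.* (T.1# T.+ constant (b j))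
    φa j = T.trans (φ.*-homo (1# - q ^ suc j) (1# - q ^ suc j)) (T.*-cong eq eq)
      where
      eq : constant (1# - q ^ suc j) T.≈ T.1# T.+ constant (b j)
      eq = T.trans (φ.+-homo 1# (- (q ^ suc j))) (T.+-congʳ φ.1#-homo)

    form-factored : form α z n actual T.≈ form α T.1# n (λ _ → 1#) T.* form T.1# α n (λ _ → 1#)
    form-factored = ≈T.begin
      form α z n actual
        ≈T.≈⟨ form-coefficients α z n a b ⟩
      TF.∏ n (λ j → α T.* constant (a j) T.+ z T.* constant (b j))
        ≈T.≈⟨ TF.∏-cong n factorisation ⟩
      TF.∏ n (λ j → (α T.* constant 1# T.+ T.1# T.* constant (b j)) T.* (T.1# T.* constant 1# T.+ α T.* constant (b j)))
        ≈T.≈⟨ TF.∏-* n (λ j → α T.* constant 1# T.+ T.1# T.* constant (b j)) (λ j → T.1# T.* constant 1# T.+ α T.* constant (b j)) ⟨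
      TF.∏ n (λ j → α T.* constant 1# T.+ T.1# T.* constant (b j)) T.* TF.∏ n (λ j → T.1# T.* constant 1# T.+ α T.* constant (b j))
        ≈T.≈⟨ T.*-cong (form-cyclotomic α T.1#) (form-cyclotomic T.1# α) ⟩
      form α T.1# n (λ _ → 1#) T.* form T.1# α n (λ _ → 1#) ≈T.∎
      where
      factorisation : ∀ j → α T.* constant (a j) T.+ z T.* constant (b j) T.≈
        (α T.* constant 1# T.+ T.1# T.* constant (b j)) T.* (T.1# T.* constant 1# T.+ α T.* constant (b j))
      factorisation j = ≈T.begin
        α T.* constant (a j) T.+ z T.* constant (b j)
          ≈T.≈⟨ T.+-congʳ (T.*-congˡ {α} (φa j)) ⟩
        α T.* ((T.1# T.+ constant (b j)) T.* (T.1# T.+ constant (b j))) T.+ z T.* constant (b j)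
          ≈T.≈⟨ TS.solve 2 (λ α y →
                  α TS.:* ((TS.con 1ℤ TS.:+ y) TS.:* (TS.con 1ℤ TS.:+ y)) TS.:+ (TS.con 1ℤ TS.:- α) TS.:* (TS.con 1ℤ TS.:- α) TS.:* y TS.:=
                  (α TS.:* TS.con 1ℤ TS.:+ TS.con 1ℤ TS.:* y) TS.:* (TS.con 1ℤ TS.:* TS.con 1ℤ TS.:+ α TS.:* y)) T.refl α (constant (b j)) ⟩
        (α T.* T.1# T.+ T.1# T.* constant (b j)) T.* (T.1# T.* T.1# T.+ α T.* constant (b j)) ≈T.∎

    -- The Lucas form of degree n + 1 unfolds to its first term 2P plus z times this tail, so the
    -- right-hand side is (1 - P)².
    form-lucas-tail : z T.* form α z n expected T.≈ T.1# T.+ P T.* P T.- P T.* (T.1# T.+ T.1#)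
    form-lucas-tail = ≈T.begin
      z T.* form α z n expected
        ≈T.≈⟨ TS.solve 2 (λ u v → u TS.:= (v TS.:+ u TS.:- v)) T.refl
                (z T.* form α z n expected) (P T.* constant (2 · 1#)) ⟩
      P T.* constant (2 · 1#) T.+ z T.* form α z n expected T.- P T.* constant (2 · 1#)
        ≈T.≈⟨ T.+-cong (form-lucas α n) (T.-‿cong (T.*-congˡ {P} (φ-fromℕ 2))) ⟩
      T.1# T.+ P T.* P T.- P T.* (T.1# T.+ (T.1# T.+ T.0#))
        ≈T.≈⟨ TS.solve 1 (λ P → TS.con 1ℤ TS.:+ P TS.:* P TS.:- P TS.:* (TS.con 1ℤ TS.:+ (TS.con 1ℤ TS.:+ TS.con 0ℤ)) TS.:=
                                TS.con 1ℤ TS.:+ P TS.:* P TS.:- P TS.:* (TS.con 1ℤ TS.:+ TS.con 1ℤ)) T.refl P ⟩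
      T.1# T.+ P T.* P T.- P T.* (T.1# T.+ T.1#) ≈T.∎

    -- Multiplied by z, each geometric sum absorbs one factor 1 - α and becomes 1 - P; the sign in
    -- between stems from (α - 1)(1 - α) = -z.
    form-coefficients≈form-lucas : form α z n actual T.≈ form α z n expected
    form-coefficients≈form-lucas = z-cancel _ _ (≈T.begin
      z T.* form α z n actual
        ≈T.≈⟨ T.*-congˡ {z} form-factored ⟩
      z T.* (F₁ T.* F₂)
        ≈T.≈⟨ TS.solve 3 (λ α u v → let 1-α = TS.con 1ℤ TS.:- α in
                1-α TS.:* 1-α TS.:* (u TS.:* v) TS.:= TS.:- ((α TS.:- TS.con 1ℤ) TS.:* u TS.:* (1-α TS.:* v)))
                T.refl α F₁ F₂ ⟩
      T.- ((α T.- T.1#) T.* F₁ T.* ((T.1# T.- α) T.* F₂))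
        ≈T.≈⟨ T.-‿cong (T.*-cong (form-geometric α T.1# n) (form-geometric T.1# α n)) ⟩
      T.- ((P T.- T.1# TE.^ suc n) T.* (T.1# TE.^ suc n T.- P))
        ≈T.≈⟨ T.-‿cong (T.*-cong (T.+-congˡ {P} (T.-‿cong 1^≈1)) (T.+-congʳ 1^≈1)) ⟩
      T.- ((P T.- T.1#) T.* (T.1# T.- P))
        ≈T.≈⟨ TS.solve 1 (λ P → TS.:- ((P TS.:- TS.con 1ℤ) TS.:* (TS.con 1ℤ TS.:- P)) TS.:=
                TS.con 1ℤ TS.:+ P TS.:* P TS.:- P TS.:* (TS.con 1ℤ TS.:+ TS.con 1ℤ)) T.refl P ⟩
      T.1# T.+ P T.* P T.- P T.* (T.1# T.+ T.1#)
        ≈T.≈⟨ form-lucas-tail ⟨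
      z T.* form α z n expected ≈T.∎)
      where
      F₁ = form α T.1# n (λ _ → 1#)
      F₂ = form T.1# α n (λ _ → 1#)
      1^≈1 = one-power (suc n)
        where
        one-power : ∀ k → T.1# TE.^ k T.≈ T.1#
        one-power zero    = T.refl
        one-power (suc k) = T.trans (T.*-identityˡ (T.1# TE.^ k)) (one-power k)

    coefficients≈lucas : ∀ t → t ≤ n → actual t ≈ expected t
    coefficients≈lucas = form-injective n actual expected form-coefficients≈form-lucas

    -- The coefficient of index 0 in `coefficients≈lucas`, as `lucas n 1` is (n + 1)².
    ∏a≈[1+n]² : ∏ n a ≈ suc n · 1# * (suc n · 1#)
    ∏a≈[1+n]² = begin
      ∏ n a                      ≈⟨ *-identityʳ _ ⟨
      ∏ n a * 1#
        -- Only t = 0 is used, where s⁰ and e₀ are 1; zeros satisfy the required relation trivially.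
        ≈⟨ coefficients-esym 0# a b (λ _ → 0#) n (λ _ _ → trans (zeroʳ _) (sym (zeroˡ _))) 0 ⟨
      actual 0 * 1#              ≈⟨ *-identityʳ _ ⟩
      actual 0                   ≈⟨ coefficients≈lucas 0 z≤n ⟩
      lucas n 1 · 1#             ≈⟨ ·-congˡ lucas≡ ⟩
      (suc n ℕ.* suc n) · 1#     ≈⟨ ·1-homo-* (suc n) (suc n) ⟩
      suc n · 1# * (suc n · 1#) ∎
      where
      lucas≡ : lucas n 1 ≡ suc n ℕ.* suc n
      lucas≡ = ≡.trans (≡.sym (ℕ.*-identityˡ _)) (≡.trans (lucas-closed n 0)
        (≡.cong (suc n ℕ.*_) (≡.trans (binomial≡C (suc n ℕ.+ 0) 1)
          (≡.trans (nC1≡n (suc n ℕ.+ 0)) (ℕ.+-identityʳ (suc n))))))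

    -- An extra factor p makes p² appear on the left, which is ∏ aⱼ, and p C(p + t, 2t + 1) on the
    -- right, which is `lucas-closed`; as p is a nonzero divisor, the factor cancels again.
    esym-closed : ∀ s x → (∀ j → j < n → b j * s ≈ x j * a j) → ∀ t → t ≤ n →
      (suc n ℕ.* suc t) · 1# * esym t (List.applyUpTo x n) ≈
      ((suc n ℕ.+ t) C (2 ℕ.* t ℕ.+ 1)) · 1# * s ^ t
    esym-closed s x bs≈xa t t≤n = x∙y⁻¹≈ε⇒x≈y _ _ (1+n-regular _ (begin
      p * ((suc n ℕ.* suc t) · 1# * e - m · 1# * s ^ t)
        ≈⟨ *-congˡ (+-congʳ (*-congʳ (·1-homo-* (suc n) (suc t)))) ⟩
      p * (p * t′ * e - m · 1# * s ^ t)
        ≈⟨ solve 5 (λ p t e m r → p :* (p :* t :* e :- m :* r) := t :* (p :* p :* e) :- p :* m :* r) refl p t′ e (m · 1#) (s ^ t) ⟩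
      t′ * (p * p * e) - p * (m · 1#) * s ^ t
        ≈⟨ +-congʳ (*-congˡ (*-congʳ ∏a≈[1+n]²)) ⟨
      t′ * (∏ n a * e) - p * (m · 1#) * s ^ t
        ≈⟨ +-congʳ (*-congˡ (coefficients-esym s a b x n bs≈xa t)) ⟨
      t′ * (actual t * s ^ t) - p * (m · 1#) * s ^ t
        ≈⟨ +-congʳ (*-congˡ (*-congʳ (coefficients≈lucas t t≤n))) ⟩
      t′ * (expected t * s ^ t) - p * (m · 1#) * s ^ t
        ≈⟨ +-congʳ (*-assoc _ _ _) ⟨
      t′ * expected t * s ^ t - p * (m · 1#) * s ^ t
        ≈⟨ +-cong (*-congʳ (·1-homo-* (suc t) (lucas n (suc t)))) (-‿cong (*-congʳ (·1-homo-* (suc n) m))) ⟨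
      (suc t ℕ.* lucas n (suc t)) · 1# * s ^ t - (suc n ℕ.* m) · 1# * s ^ t
        ≈⟨ x≈y⇒x∙y⁻¹≈ε (*-congʳ (·-congˡ closed)) ⟩
      0# ∎))
      where
      p = suc n · 1#
      t′ = suc t · 1#
      m = (suc n ℕ.+ t) C (2 ℕ.* t ℕ.+ 1)
      e = esym t (List.applyUpTo x n)
      closed : suc t ℕ.* lucas n (suc t) ≡ suc n ℕ.* m
      closed = ≡.trans (lucas-closed n t) (≡.cong (suc n ℕ.*_) (binomial≡C (suc n ℕ.+ t) (2 ℕ.* t ℕ.+ 1)))

-- q-numbers and their inverses

module QNumbers {c ℓ : Level} (R : CommutativeRing c ℓ) (q : CommutativeRing.Carrier R) where
  open CommutativeRing R hiding (zero)
  open IntegerSolver R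
  open Exponentiation semiring using (_^_)
  open Multiples semiring using () renaming (_×_ to _·_)
  open ≈-Reasoning setoid

  ⟦_⟧ : ℕ → Carrier
  ⟦ zero  ⟧ = 0#
  ⟦ suc n ⟧ = 1# + q * ⟦ n ⟧

  -- Identifies the coefficient lists `[ n ]q` with these q-numbers in the residue ring.
  ⟦⟧-unique : ∀ (b : ℕ → Carrier) → b 0 ≈ 0# → (∀ n → b (suc n) ≈ 1# + q * b n) →
    ∀ n → b n ≈ ⟦ n ⟧
  ⟦⟧-unique b b₀≈0 b-suc zero    = b₀≈0
  ⟦⟧-unique b b₀≈0 b-suc (suc n) =
    trans (b-suc n) (+-congˡ (*-congˡ (⟦⟧-unique b b₀≈0 b-suc n)))

  [1-q]⟦n⟧≈1-qⁿ : ∀ n → (1# - q) * ⟦ n ⟧ ≈ 1# - q ^ n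
  [1-q]⟦n⟧≈1-qⁿ zero    = solve 1 (λ q → (con 1ℤ :- q) :* con 0ℤ := con 1ℤ :- con 1ℤ) refl q
  [1-q]⟦n⟧≈1-qⁿ (suc n) = begin
    (1# - q) * (1# + q * ⟦ n ⟧)
      ≈⟨ solve 2 (λ q b → (con 1ℤ :- q) :* (con 1ℤ :+ q :* b) := con 1ℤ :- q :+ q :* ((con 1ℤ :- q) :* b)) refl q ⟦ n ⟧ ⟩
    1# - q + q * ((1# - q) * ⟦ n ⟧)
      ≈⟨ +-congˡ (*-congˡ ([1-q]⟦n⟧≈1-qⁿ n)) ⟩
    1# - q + q * (1# - q ^ n)
      ≈⟨ solve 2 (λ q p → con 1ℤ :- q :+ q :* (con 1ℤ :- p) := con 1ℤ :- q :* p) refl q (q ^ n) ⟩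
    1# - q ^ suc n ∎

  ⟦+⟧ : ∀ m n → ⟦ m ℕ.+ n ⟧ ≈ ⟦ m ⟧ + q ^ m * ⟦ n ⟧
  ⟦+⟧ zero    n = solve 1 (λ b → b := con 0ℤ :+ con 1ℤ :* b) refl ⟦ n ⟧
  ⟦+⟧ (suc m) n = begin
    1# + q * ⟦ m ℕ.+ n ⟧
      ≈⟨ +-congˡ (*-congˡ (⟦+⟧ m n)) ⟩
    1# + q * (⟦ m ⟧ + q ^ m * ⟦ n ⟧)
      ≈⟨ solve 4 (λ q a p b → con 1ℤ :+ q :* (a :+ p :* b) := con 1ℤ :+ q :* a :+ q :* p :* b) refl q ⟦ m ⟧ (q ^ m) ⟦ n ⟧ ⟩
    1# + q * ⟦ m ⟧ + q ^ suc m * ⟦ n ⟧ ∎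

  -- The cofactor is the q-number of m with qⁿ in place of q.
  ⟦*⟧ : ∀ m n → ∃ λ v → ⟦ m ℕ.* n ⟧ ≈ ⟦ n ⟧ * v
  ⟦*⟧ zero    n = 0# , sym (zeroʳ _)
  ⟦*⟧ (suc m) n with ⟦*⟧ m n
  ... | v , eq = 1# + q ^ n * v , (begin
    ⟦ n ℕ.+ m ℕ.* n ⟧              ≈⟨ ⟦+⟧ n (m ℕ.* n) ⟩
    ⟦ n ⟧ + q ^ n * ⟦ m ℕ.* n ⟧    ≈⟨ +-congˡ (*-congˡ eq) ⟩
    ⟦ n ⟧ + q ^ n * (⟦ n ⟧ * v)    ≈⟨ solve 3 (λ b p v → b :+ p :* (b :* v) := b :* (con 1ℤ :+ p :* v)) refl _ _ _ ⟩
    ⟦ n ⟧ * (1# + q ^ n * v)       ∎)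

  -- At q = 1 the q-number becomes n; as a congruence modulo 1 - q, this carries regularity from the
  -- integer n over to 1 - q.
  n≈⟦n⟧+[1-q]w : ∀ n → ∃ λ w → n · 1# ≈ ⟦ n ⟧ + (1# - q) * w
  n≈⟦n⟧+[1-q]w zero    = 0# , solve 1 (λ q → con 0ℤ := con 0ℤ :+ (con 1ℤ :- q) :* con 0ℤ) refl q
  n≈⟦n⟧+[1-q]w (suc n) with n≈⟦n⟧+[1-q]w n
  ... | w , eq = w + ⟦ n ⟧ , (begin
    1# + n · 1#                     ≈⟨ +-congˡ eq ⟩
    1# + (⟦ n ⟧ + (1# - q) * w)
      ≈⟨ solve 3 (λ q b w → con 1ℤ :+ (b :+ (con 1ℤ :- q) :* w) := con 1ℤ :+ q :* b :+ (con 1ℤ :- q) :* (w :+ b)) refl q ⟦ n ⟧ w ⟩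
    1# + q * ⟦ n ⟧ + (1# - q) * (w + ⟦ n ⟧) ∎)

  module _ (p : ℕ) (⟦p⟧≈0 : ⟦ p ⟧ ≈ 0#) where

    ⟦*p⟧≈0 : ∀ m → ⟦ m ℕ.* p ⟧ ≈ 0#
    ⟦*p⟧≈0 m with ⟦*⟧ m p
    ... | v , eq = trans eq (trans (*-congʳ ⟦p⟧≈0) (zeroˡ v))

    ⟦1+*p⟧≈1 : ∀ m → ⟦ 1 ℕ.+ m ℕ.* p ⟧ ≈ 1#
    ⟦1+*p⟧≈1 m = trans (+-congˡ (trans (*-congˡ (⟦*p⟧≈0 m)) (zeroʳ q))) (+-identityʳ 1#)

    q^p≈1 : q ^ p ≈ 1#
    q^p≈1 = begin
      q ^ p                       ≈⟨ solve 1 (λ x → x := con 1ℤ :- (con 1ℤ :- x)) refl (q ^ p) ⟩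
      1# - (1# - q ^ p)           ≈⟨ +-congˡ (-‿cong ([1-q]⟦n⟧≈1-qⁿ p)) ⟨
      1# - (1# - q) * ⟦ p ⟧       ≈⟨ +-congˡ (-‿cong (*-congˡ ⟦p⟧≈0)) ⟩
      1# - (1# - q) * 0#          ≈⟨ solve 1 (λ x → con 1ℤ :- x :* con 0ℤ := con 1ℤ) refl (1# - q) ⟩
      1#                          ∎

    -- [k] divides [yk], and yk ≡ ±1 modulo p for a Bézout coefficient y.

    ⟦⟧-invertible : ∀ {k} → Coprime p k → ∃ λ u → ⟦ k ⟧ * u ≈ 1#
    ⟦⟧-invertible {k} coprime with coprime-Bézout coprime
    ⟦⟧-invertible {k} coprime | Bézout.+- x y 1+yk≡xp with ⟦*⟧ y k
    -- Since 1 + yk = xp, the sum 1 + q [yk] is [xp] and vanishes, so q [yk] = -1.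
    ... | v , eq = - (q * v) , (begin
      ⟦ k ⟧ * - (q * v)
        ≈⟨ solve 3 (λ q b v → b :* :- (q :* v) := con 1ℤ :- (con 1ℤ :+ q :* (b :* v))) refl q ⟦ k ⟧ v ⟩
      1# - (1# + q * (⟦ k ⟧ * v))
        ≈⟨ +-congˡ (-‿cong (+-congˡ (*-congˡ eq))) ⟨
      1# - ⟦ 1 ℕ.+ y ℕ.* k ⟧
        ≡⟨ ≡.cong (λ m → 1# - ⟦ m ⟧) 1+yk≡xp ⟩
      1# - ⟦ x ℕ.* p ⟧
        ≈⟨ +-congˡ (-‿cong (⟦*p⟧≈0 x)) ⟩
      1# - 0#
        ≈⟨ solve 0 (con 1ℤ :- con 0ℤ := con 1ℤ) refl ⟩
      1# ∎)
    ⟦⟧-invertible {k} coprime | Bézout.-+ x y 1+xp≡yk with ⟦*⟧ y k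
    ... | v , eq = v , (begin
      ⟦ k ⟧ * v              ≈⟨ eq ⟨
      ⟦ y ℕ.* k ⟧            ≡⟨ ≡.cong ⟦_⟧ 1+xp≡yk ⟨
      ⟦ 1 ℕ.+ x ℕ.* p ⟧      ≈⟨ ⟦1+*p⟧≈1 x ⟩
      1#                     ∎)

-- Residues up to integer torsion

-- The quotient of R by the ideal of all x with n x ∈ (Φ) for some n ≥ 1, that
-- is, the image of R in (R ⊗ ℚ) / (Φ).

module TorsionFreeQuotient {c ℓ : Level} (R : CommutativeRing c ℓ) (Φ : CommutativeRing.Carrier R) where
  open CommutativeRing R hiding (zero)
  open IntegerSolver R
  open Multiples semiring using () renaming (_×_ to _·_; ×1-homo-* to ·1-homo-*)
  open ≈-Reasoning setoid

  infix 4 _~_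
  record _~_ (x y : Carrier) : Set (c ⊔ ℓ) where
    constructor witness
    field
      multiplier-1 : ℕ
      quotient     : Carrier
      equality     : suc multiplier-1 · 1# * (x - y) ≈ quotient * Φ

  ≈⇒~ : ∀ {x y} → x ≈ y → x ~ y
  ≈⇒~ {x} {y} x≈y = witness 0 0# (begin
    1 · 1# * (x - y)   ≈⟨ *-congˡ (+-congʳ x≈y) ⟩
    1 · 1# * (y - y)   ≈⟨ solve 3 (λ m y Φ → m :* (y :- y) := con 0ℤ :* Φ) refl (1 · 1#) y Φ ⟩
    0# * Φ             ∎)

  -- This and `~-add` carry all the ring congruences: each rule only writes its difference as a
  -- multiple or a sum of given differences.
  ~-scale : ∀ {x y x′ y′} a → x′ - y′ ≈ a * (x - y) → x ~ y → x′ ~ y′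
  ~-scale {x} {y} {x′} {y′} a eq′ (witness n w eq) = witness n (a * w) (begin
    suc n · 1# * (x′ - y′)       ≈⟨ *-congˡ eq′ ⟩
    suc n · 1# * (a * (x - y))   ≈⟨ solve 3 (λ m a d → m :* (a :* d) := a :* (m :* d)) refl _ a (x - y) ⟩
    a * (suc n · 1# * (x - y))   ≈⟨ *-congˡ eq ⟩
    a * (w * Φ)                  ≈⟨ *-assoc a w Φ ⟨
    a * w * Φ                    ∎)

  ~-add : ∀ {x y x′ y′ x″ y″} → x″ - y″ ≈ (x - y) + (x′ - y′) → x ~ y → x′ ~ y′ → x″ ~ y″
  ~-add {x} {y} {x′} {y′} {x″} {y″} eq″ (witness m v eq) (witness n w eq′) =
    -- The number n + m (1 + n) is the predecessor of (1 + m)(1 + n), by reduction; the same index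
    -- recurs below.
    witness (n ℕ.+ m ℕ.* suc n) (suc n · 1# * v + suc m · 1# * w) (begin
    (suc m ℕ.* suc n) · 1# * (x″ - y″)
      ≈⟨ *-cong (·1-homo-* (suc m) (suc n)) eq″ ⟩
    suc m · 1# * suc n · 1# * ((x - y) + (x′ - y′))
      ≈⟨ solve 4 (λ m n d e → m :* n :* (d :+ e) := n :* (m :* d) :+ m :* (n :* e))
           refl (suc m · 1#) (suc n · 1#) (x - y) (x′ - y′) ⟩
    suc n · 1# * (suc m · 1# * (x - y)) + suc m · 1# * (suc n · 1# * (x′ - y′))
      ≈⟨ +-cong (*-congˡ eq) (*-congˡ eq′) ⟩
    suc n · 1# * (v * Φ) + suc m · 1# * (w * Φ)
      ≈⟨ solve 5 (λ m n v w Φ → n :* (v :* Φ) :+ m :* (w :* Φ) := (n :* v :+ m :* w) :* Φ)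
           refl (suc m · 1#) (suc n · 1#) v w Φ ⟩
    (suc n · 1# * v + suc m · 1# * w) * Φ ∎)

  ~-sym : ∀ {x y} → x ~ y → y ~ x
  ~-sym {x} {y} = ~-scale (- 1#) (solve 2 (λ x y → y :- x := :- con 1ℤ :* (x :- y)) refl x y)

  ~-trans : ∀ {x y z} → x ~ y → y ~ z → x ~ z
  ~-trans {x} {y} {z} = ~-add (solve 3 (λ x y z → x :- z := (x :- y) :+ (y :- z)) refl x y z)

  +-~-cong : ∀ {x x′ y y′} → x ~ x′ → y ~ y′ → x + y ~ x′ + y′
  +-~-cong {x} {x′} {y} {y′} = ~-add
    (solve 4 (λ x x′ y y′ → x :+ y :- (x′ :+ y′) := (x :- x′) :+ (y :- y′)) refl x x′ y y′)

  *-~-congˡ : ∀ a {x y} → x ~ y → a * x ~ a * y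
  *-~-congˡ a {x} {y} = ~-scale a (solve 3 (λ a x y → a :* x :- a :* y := a :* (x :- y)) refl a x y)

  *-~-cong : ∀ {x x′ y y′} → x ~ x′ → y ~ y′ → x * y ~ x′ * y′
  *-~-cong {x} {x′} {y} {y′} x~x′ y~y′ = ~-trans (*-~-congˡ x y~y′)
    (~-scale y′ (solve 3 (λ x x′ y′ → x :* y′ :- x′ :* y′ := y′ :* (x :- x′)) refl x x′ y′) x~x′)

  -‿~-cong : ∀ {x y} → x ~ y → - x ~ - y
  -‿~-cong {x} {y} = ~-scale (- 1#) (solve 2 (λ x y → :- x :- :- y := :- con 1ℤ :* (x :- y)) refl x y)

  commutativeRing : CommutativeRing c (c ⊔ ℓ)
  commutativeRing = record
    { Carrier = Carrier
    ; _≈_     = _~_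
    ; _+_     = _+_
    ; _*_     = _*_
    ; -_      = -_
    ; 0#      = 0#
    ; 1#      = 1#
    ; isCommutativeRing = record
      { isRing = record
        { +-isAbelianGroup = record
          { isGroup = record
            { isMonoid = record
              { isSemigroup = record
                { isMagma = record
                  { isEquivalence = record
                    { refl = ≈⇒~ refl ; sym = ~-sym ; trans = ~-trans }
                  ; ∙-cong = +-~-cong
                  }
                ; assoc = λ x y z → ≈⇒~ (+-assoc x y z)
                }
              ; identity = (λ x → ≈⇒~ (+-identityˡ x)) , (λ x → ≈⇒~ (+-identityʳ x))
              }
            ; inverse = (λ x → ≈⇒~ (-‿inverseˡ x)) , (λ x → ≈⇒~ (-‿inverseʳ x))
            ; ⁻¹-cong = -‿~-cong
            }
          ; comm = λ x y → ≈⇒~ (+-comm x y)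
          }
        ; *-cong     = *-~-cong
        ; *-assoc    = λ x y z → ≈⇒~ (*-assoc x y z)
        ; *-identity = (λ x → ≈⇒~ (*-identityˡ x)) , (λ x → ≈⇒~ (*-identityʳ x))
        ; distrib    = (λ x y z → ≈⇒~ (distribˡ x y z)) , (λ x y z → ≈⇒~ (distribʳ x y z))
        }
      ; *-comm = λ x y → ≈⇒~ (*-comm x y)
      }
    }

  Φ~0 : Φ ~ 0#
  Φ~0 = witness 0 1# (solve 1 (λ Φ → (con 1ℤ :+ con 0ℤ) :* (Φ :- con 0ℤ) := con 1ℤ :* Φ) refl Φ)

  -- Says that d is a unit in (R ⊗ ℚ) / (Φ), with the denominator of the inverse cleared. The
  -- explicit cofactor yields both cancellation and coprimality.
  record Regular (d : Carrier) : Set (c ⊔ ℓ) where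
    constructor regular
    field
      norm-1   : ℕ
      cofactor : Carrier
      equality : d * cofactor ~ suc norm-1 · 1#

  Regular-* : ∀ {d e} → Regular d → Regular e → Regular (d * e)
  Regular-* {d} {e} (regular m u du~m) (regular n v ev~n) =
    regular (n ℕ.+ m ℕ.* suc n) (u * v) (~-trans
      (≈⇒~ (solve 4 (λ d e u v → d :* e :* (u :* v) := d :* u :* (e :* v)) refl d e u v))
      (~-trans (*-~-cong du~m ev~n) (≈⇒~ (sym (·1-homo-* (suc m) (suc n))))))

  multiple-regular : ∀ n → Regular (suc n · 1#)
  multiple-regular n = regular n 1# (≈⇒~ (*-identityʳ _))

  unit-regular : ∀ {d u} → d * u ~ 1# → Regular d
  unit-regular {d} {u} du~1 = regular 0 u (~-trans du~1 (≈⇒~ (sym (+-identityʳ 1#))))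

  Regular-cong : ∀ {d e} → d ≈ e → Regular d → Regular e
  Regular-cong d≈e (regular n u du~n) = regular n u (~-trans (≈⇒~ (*-congʳ (sym d≈e))) du~n)

  -- The cofactor replaces d by a positive integer, which the multiplier inside `_~_` then absorbs.
  Regular⇒nonZeroDivisor : ∀ {d} → Regular d → ∀ x → d * x ~ 0# → x ~ 0#
  Regular⇒nonZeroDivisor {d} (regular n u du~n) x dx~0 = divide (~-trans
    (~-trans (*-~-cong (~-sym du~n) (≈⇒~ refl))
      (≈⇒~ (solve 3 (λ d u x → d :* u :* x := u :* (d :* x)) refl d u x)))
    (*-~-congˡ u dx~0))
    where
    divide : suc n · 1# * x ~ u * 0# → x ~ 0#
    divide (witness m w eq) = witness (n ℕ.+ m ℕ.* suc n) w (begin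
      (suc m ℕ.* suc n) · 1# * (x - 0#)            ≈⟨ *-congʳ (·1-homo-* (suc m) (suc n)) ⟩
      suc m · 1# * suc n · 1# * (x - 0#)
        ≈⟨ solve 4 (λ m n x u → m :* n :* (x :- con 0ℤ) := m :* (n :* x :- u :* con 0ℤ)) refl (suc m · 1#) (suc n · 1#) x u ⟩
      suc m · 1# * (suc n · 1# * x - u * 0#)       ≈⟨ eq ⟩
      w * Φ                                        ∎)

-- Coprimality after extending the ring, and identities of fractions

module RegularImage {c ℓ c′ ℓ′ : Level} (R : CommutativeRing c ℓ) (R′ : CommutativeRing c′ ℓ′)
  (ι : CommutativeRing.Carrier R → CommutativeRing.Carrier R′)
  (ι-cong : ∀ {x y} → CommutativeRing._≈_ R x y → CommutativeRing._≈_ R′ (ι x) (ι y))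
  (ι-+ : ∀ x y → CommutativeRing._≈_ R′ (ι (CommutativeRing._+_ R x y)) (CommutativeRing._+_ R′ (ι x) (ι y)))
  (ι-* : ∀ x y → CommutativeRing._≈_ R′ (ι (CommutativeRing._*_ R x y)) (CommutativeRing._*_ R′ (ι x) (ι y)))
  where
  private module R = CommutativeRing R
  open CommutativeRing R′ hiding (zero)
  open IntegerSolver R′
  open Multiples R.semiring using () renaming (_×_ to _·_; ×1-homo-* to ·1-homo-*)
  open ≈-Reasoning setoid

  -- Regularity of d unfolds to a Bézout relation M d u = M N + w Φ with positive integers M and N.
  -- A common divisor of ι d and ι Φ therefore divides ι (M N), which is invertible in `R′`.
  commonDivisor-invertible : ∀ {Φ d} → TorsionFreeQuotient.Regular R Φ d →
    (∀ n → ∃ λ k → k * ι (suc n · R.1#) ≈ 1#) →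
    ∀ z a b → a * z ≈ ι d → b * z ≈ ι Φ → ∃ λ v → v * z ≈ 1#
  commonDivisor-invertible {Φ} {d} (TorsionFreeQuotient.regular n u (TorsionFreeQuotient.witness m w eq)) inverse z a b az≈d bz≈Φ
    with inverse (n ℕ.+ m ℕ.* suc n)
  ... | k , kMN≈1 = k * (ι M * (a * ι u) - ι w * b) , (begin
    k * (ι M * (a * ι u) - ι w * b) * z
      ≈⟨ solve 7 (λ k M a u w b z → k :* (M :* (a :* u) :- w :* b) :* z :=
           k :* (M :* (a :* z :* u) :- w :* (b :* z))) refl k (ι M) a (ι u) (ι w) b z ⟩
    k * (ι M * (a * z * ι u) - ι w * (b * z))
      ≈⟨ *-congˡ (+-cong (*-congˡ (*-congʳ az≈d)) (-‿cong (*-congˡ bz≈Φ))) ⟩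
    k * (ι M * (ι d * ι u) - ι w * ι Φ)
      ≈⟨ *-congˡ (+-congʳ ιMdu) ⟩
    k * (ι (M R.* N) + ι w * ι Φ - ι w * ι Φ)
      ≈⟨ solve 3 (λ k x y → k :* (x :+ y :- y) := k :* x) refl k (ι (M R.* N)) (ι w * ι Φ) ⟩
    k * ι (M R.* N)
      ≈⟨ *-congˡ (ι-cong (·1-homo-* (suc m) (suc n))) ⟨
    k * ι ((suc m ℕ.* suc n) · R.1#)
      ≈⟨ kMN≈1 ⟩
    1# ∎)
    where
    M = suc m · R.1#
    N = suc n · R.1#
    Mdu : M R.* (d R.* u) R.≈ M R.* N R.+ w R.* Φ
    Mdu = R.trans
      -- The relation is solved for its positive side, since ι is only given to respect sums and
      -- products.
      (IntegerSolver.solve R 3 (λ M x N → M S.:* x S.:= M S.:* N S.:+ M S.:* (x S.:- N)) R.refl M (d R.* u) N)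
      (R.+-congˡ eq)
      where module S = IntegerSolver R
    ιMdu : ι M * (ι d * ι u) ≈ ι (M R.* N) + ι w * ι Φ
    ιMdu = begin
      ι M * (ι d * ι u)              ≈⟨ *-congˡ (ι-* d u) ⟨
      ι M * ι (d R.* u)              ≈⟨ ι-* M (d R.* u) ⟨
      ι (M R.* (d R.* u))            ≈⟨ ι-cong Mdu ⟩
      ι (M R.* N R.+ w R.* Φ)        ≈⟨ ι-+ _ _ ⟩
      ι (M R.* N) + ι (w R.* Φ)      ≈⟨ +-congˡ (ι-* w Φ) ⟩
      ι (M R.* N) + ι w * ι Φ        ∎

module FractionIdentities {c ℓ : Level} (R : CommutativeRing c ℓ) where
  open CommutativeRing R
  open IntegerSolver R
  open ≈-Reasoning setoid

  -- Equality of the fraction x / y with its expansion by m; `x - 0#` is the shape in which a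
  -- witness of `x ~ 0#` holds the numerator.
  cross : ∀ m x y → x * (m * y) ≈ m * (x - 0#) * y
  cross m x y = solve 3 (λ m x y → x :* (m :* y) := m :* (x :- con 0ℤ) :* y) refl m x y

  -- The left-hand side is the numerator to which `x - y /ℕ N` unfolds for fractions f / g and f′ /
  -- g′ with residues v and w.
  numerator-vanishes : ∀ f g f′ g′ N v w → f ≈ v * g → f′ ≈ w * g′ → N * v ≈ w →
    f * (g′ * N) + - (f′ * 1#) * g ≈ 0#
  numerator-vanishes f g f′ g′ N v w f≈vg f′≈wg′ Nv≈w = begin
    f * (g′ * N) + - (f′ * 1#) * g
      ≈⟨ +-cong (*-congʳ f≈vg) (*-congʳ (-‿cong (*-congʳ f′≈wg′))) ⟩
    v * g * (g′ * N) + - (w * g′ * 1#) * g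
      ≈⟨ solve 5 (λ v w g g′ N → v :* g :* (g′ :* N) :+ :- (w :* g′ :* con 1ℤ) :* g :=
                                 g :* g′ :* (N :* v :- w)) refl v w g g′ N ⟩
    g * g′ * (N * v - w)
      ≈⟨ *-congˡ (+-congʳ Nv≈w) ⟩
    g * g′ * (w - w)
      ≈⟨ solve 2 (λ w d → d :* (w :- w) := con 0ℤ) refl w (g * g′) ⟩
    0# ∎

-- Sums over subsequences as elementary symmetric functions

module SubsequenceSums {c ℓ : Level} (S : CommutativeRing c ℓ) where
  open CommutativeRing S hiding (zero)
  open IntegerSolver S
  open Exponentiation semiring using (_^_; ^-assocʳ)
  open EsymAtRootsOfUnity S using (esym) public
  open ≈-Reasoning setoid

  sum : List Carrier → Carrier
  sum = List.foldr _+_ 0#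

  product : ∀ {l} → Vec Carrier l → Carrier
  product = Vec.foldr′ _*_ 1#

  sum-++ : ∀ xs ys → sum (xs ++ ys) ≈ sum xs + sum ys
  sum-++ []       ys = sym (+-identityˡ _)
  sum-++ (x ∷ xs) ys = trans (+-congˡ (sum-++ xs ys)) (sym (+-assoc _ _ _))

  sum-scale : ∀ {A : Set} a (f : A → Carrier) xs →
    sum (List.map (λ x → a * f x) xs) ≈ a * sum (List.map f xs)
  sum-scale a f []       = sym (zeroʳ a)
  sum-scale a f (x ∷ xs) = trans (+-congˡ (sum-scale a f xs)) (sym (distribˡ _ _ _))

  -- Splitting by whether the first entry is chosen mirrors the recursion of `esym`.
  sum-subsequences : ∀ {A : Set} (x : A → Carrier) t js →
    sum (List.map (product ∘ Vec.map x) (subsequences t js)) ≈ esym t (List.map x js)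
  sum-subsequences x zero    js       = +-identityʳ 1#
  sum-subsequences x (suc t) []       = refl
  sum-subsequences x (suc t) (j ∷ js) = begin
    sum (List.map F (List.map (j ∷_) (subsequences t js) ++ subsequences (suc t) js))
      ≡⟨ ≡.cong sum (List.map-++ F (List.map (j ∷_) (subsequences t js)) (subsequences (suc t) js)) ⟩
    sum (List.map F (List.map (j ∷_) (subsequences t js)) ++ List.map F (subsequences (suc t) js))
      ≈⟨ sum-++ (List.map F (List.map (j ∷_) (subsequences t js))) _ ⟩
    sum (List.map F (List.map (j ∷_) (subsequences t js))) + sum (List.map F (subsequences (suc t) js))
      ≡⟨ ≡.cong (λ xs → sum xs + sum (List.map F (subsequences (suc t) js))) (List.map-∘ (subsequences t js)) ⟨
    sum (List.map (λ ks → x j * F ks) (subsequences t js)) + sum (List.map F (subsequences (suc t) js))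
      ≈⟨ +-cong (sum-scale (x j) F (subsequences t js)) (sum-subsequences x (suc t) js) ⟩
    x j * sum (List.map F (subsequences t js)) + esym (suc t) (List.map x js)
      ≈⟨ +-congʳ (*-congˡ (sum-subsequences x t js)) ⟩
    x j * esym t (List.map x js) + esym (suc t) (List.map x js) ∎
    where
    F : ∀ {l} → Vec _ l → Carrier
    F = product ∘ Vec.map x

  neg-square-^ : ∀ d t → (- (d * d)) ^ t ≈ (- 1#) ^ t * d ^ (2 ℕ.* t)
  neg-square-^ d t = trans (powers t) (*-congˡ (^-assocʳ d 2 t))
    where
    powers : ∀ t → (- (d * d)) ^ t ≈ (- 1#) ^ t * (d ^ 2) ^ t
    powers zero    = sym (*-identityˡ 1#)
    powers (suc t) = trans (*-congˡ (powers t))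
      (solve 3 (λ d u v → :- (d :* d) :* (u :* v) := :- con 1ℤ :* u :* (d :* (d :* con 1ℤ) :* v))
        refl d ((- 1#) ^ t) ((d ^ 2) ^ t))

-- Choice of inverses and the closed formula for eₜ

-- Inverses of [j + 1] are available only for j < n, while the sequences above are indexed by all of
-- ℕ; the default fills the remaining places.
bounded-choice : ∀ {a b} {A : Set a} {P : ℕ → A → Set b} n → A → (∀ j → j < n → ∃ (P j)) →
                 ∃ λ (f : ℕ → A) → ∀ j → j < n → P j (f j)
bounded-choice {A = A} {P} n default choose = f , f-satisfies
  where
  f : ℕ → A
  f j with j ℕ.<? n
  ... | yes j<n = proj₁ (choose j j<n)
  ... | no  _   = default
  f-satisfies : ∀ j → j < n → P j (f j)
  f-satisfies j j<n with j ℕ.<? n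
  ... | yes j<n′ = proj₂ (choose j j<n′)
  ... | no  j≮n  = contradiction j<n j≮n

module QNumberInverses {c ℓ : Level} (S : CommutativeRing c ℓ) (q : CommutativeRing.Carrier S) where
  open CommutativeRing S using (Carrier; _≈_; _*_; 0#; 1#)
  open QNumbers S q using (⟦_⟧; ⟦⟧-invertible)

  ⟦⟧-inverses : ∀ {n} → Prime (suc n) → ⟦ suc n ⟧ ≈ 0# →
    ∃ λ (u : ℕ → Carrier) → ∀ j → j < n → ⟦ suc j ⟧ * u j ≈ 1#
  ⟦⟧-inverses {n} pr ⟦1+n⟧≈0 = bounded-choice n 0# λ j j<n →
    ⟦⟧-invertible (suc n) ⟦1+n⟧≈0 (prime⇒coprime pr (s≤s j<n))

module Cyclotomic {c ℓ : Level} (S : CommutativeRing c ℓ) (q : CommutativeRing.Carrier S)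
  (n : ℕ) (⟦1+n⟧≈0 : CommutativeRing._≈_ S (QNumbers.⟦_⟧ S q (suc n)) (CommutativeRing.0# S))
  (1+n-nonZeroDivisor : EsymAtRootsOfUnity.NonZeroDivisor S
    (Multiples._×_ (CommutativeRing.semiring S) (suc n) (CommutativeRing.1# S)))
  (u : ℕ → CommutativeRing.Carrier S)
  (⟦1+j⟧u≈1 : ∀ j → j < n → CommutativeRing._≈_ S
    (CommutativeRing._*_ S (QNumbers.⟦_⟧ S q (suc j)) (u j)) (CommutativeRing.1# S))
  where
  open CommutativeRing S hiding (zero)
  open IntegerSolver S
  open Exponentiation semiring using (_^_; ^-congʳ)
  open Multiples semiring using () renaming (_×_ to _·_)
  open QNumbers S q
  open EsymAtRootsOfUnity S using (esym; esym-closed; NonZeroDivisor)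
  open SubsequenceSums S using (neg-square-^)
  open ≈-Reasoning setoid

  -- As [n + 1] vanishes, the integer n + 1 is a multiple of 1 - q, and a factor of a nonzero
  -- divisor is a nonzero divisor.
  1-q-nonZeroDivisor : NonZeroDivisor (1# - q)
  1-q-nonZeroDivisor y [1-q]y≈0 with n≈⟦n⟧+[1-q]w (suc n)
  ... | w , eq = 1+n-nonZeroDivisor y (begin
    suc n · 1# * y                      ≈⟨ *-congʳ eq ⟩
    (⟦ suc n ⟧ + (1# - q) * w) * y      ≈⟨ *-congʳ (+-congʳ ⟦1+n⟧≈0) ⟩
    (0# + (1# - q) * w) * y
      ≈⟨ solve 3 (λ d w y → (con 0ℤ :+ d :* w) :* y := w :* (d :* y)) refl (1# - q) w y ⟩
    w * ((1# - q) * y)                  ≈⟨ *-congˡ [1-q]y≈0 ⟩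
    w * 0#                              ≈⟨ zeroʳ w ⟩
    0#                                  ∎)

  1-qʲ-nonZeroDivisor : ∀ j → j < n → NonZeroDivisor (1# - q ^ suc j)
  1-qʲ-nonZeroDivisor j j<n y eq = 1-q-nonZeroDivisor y (begin
    (1# - q) * y
      ≈⟨ *-identityʳ _ ⟨
    (1# - q) * y * 1#
      ≈⟨ *-congˡ (⟦1+j⟧u≈1 j j<n) ⟨
    (1# - q) * y * (⟦ suc j ⟧ * u j)
      ≈⟨ solve 4 (λ d y b u → d :* y :* (b :* u) := d :* b :* y :* u) refl (1# - q) y ⟦ suc j ⟧ (u j) ⟩
    (1# - q) * ⟦ suc j ⟧ * y * u j
      ≈⟨ *-congʳ (*-congʳ ([1-q]⟦n⟧≈1-qⁿ (suc j))) ⟩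
    (1# - q ^ suc j) * y * u j
      ≈⟨ *-congʳ eq ⟩
    0# * u j
      ≈⟨ zeroˡ (u j) ⟩
    0# ∎)

  -- The exponent has the form to which `(2 ∸ 1) ℕ.* suc j` in `factor 2 j` reduces.
  x : ℕ → Carrier
  x j = q ^ (1 ℕ.* suc j) * (u j * u j)

  s : Carrier
  s = - ((1# - q) * (1# - q))

  scaling : ∀ j → j < n →
    - (q ^ suc j) * s ≈ x j * ((1# - q ^ suc j) * (1# - q ^ suc j))
  scaling j j<n = begin
    - Q * s
      ≈⟨ solve 2 (λ Q d → :- Q :* :- (d :* d) := Q :* (d :* d) :* (con 1ℤ :* con 1ℤ)) refl Q (1# - q) ⟩
    Q * ((1# - q) * (1# - q)) * (1# * 1#)
      -- Two copies of 1 = [k] u are inserted: the q-numbers turn (1 - q)² into (1 - qᵏ)², and the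
      -- inverses make up `x j`.
      ≈⟨ *-congˡ (*-cong (⟦1+j⟧u≈1 j j<n) (⟦1+j⟧u≈1 j j<n)) ⟨
    Q * ((1# - q) * (1# - q)) * (B * u j * (B * u j))
      ≈⟨ solve 4 (λ Q d B u → Q :* (d :* d) :* (B :* u :* (B :* u)) := Q :* (u :* u) :* (d :* B :* (d :* B)))
           refl Q (1# - q) B (u j) ⟩
    Q * (u j * u j) * ((1# - q) * B * ((1# - q) * B))
      ≈⟨ *-cong (*-congʳ (^-congʳ q (≡.sym (ℕ.*-identityˡ (suc j)))))
                (*-cong ([1-q]⟦n⟧≈1-qⁿ (suc j)) ([1-q]⟦n⟧≈1-qⁿ (suc j))) ⟩
    x j * ((1# - Q) * (1# - Q)) ∎
    where
    Q = q ^ suc j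
    B = ⟦ suc j ⟧

  esym-formula : ∀ t → t ≤ n →
    (suc n ℕ.* suc t) · 1# * esym t (List.applyUpTo x n) ≈
    (- 1#) ^ t * ((suc n ℕ.+ t) C (2 ℕ.* t ℕ.+ 1)) · 1# * (1# - q) ^ (2 ℕ.* t)
  esym-formula t t≤n = begin
    (suc n ℕ.* suc t) · 1# * esym t (List.applyUpTo x n)
      ≈⟨ esym-closed q n (q^p≈1 (suc n) ⟦1+n⟧≈0) 1-qʲ-nonZeroDivisor 1+n-nonZeroDivisor s x scaling t t≤n ⟩
    m · 1# * s ^ t
      ≈⟨ *-congˡ (neg-square-^ (1# - q) t) ⟩
    m · 1# * ((- 1#) ^ t * (1# - q) ^ (2 ℕ.* t))
      ≈⟨ solve 3 (λ m a b → m :* (a :* b) := a :* m :* b) refl (m · 1#) _ _ ⟩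
    (- 1#) ^ t * m · 1# * (1# - q) ^ (2 ℕ.* t) ∎
    where m = (suc n ℕ.+ t) C (2 ℕ.* t ℕ.+ 1)

module InverseSquare {c ℓ : Level} (S : CommutativeRing c ℓ) where
  open CommutativeRing S
  open IntegerSolver S

  inverse-square : ∀ {b u} → b * u ≈ 1# → b * (b * 1#) * (u * u) ≈ 1#
  inverse-square {b} {u} bu≈1 = trans
    (solve 2 (λ b u → b :* (b :* con 1ℤ) :* (u :* u) := b :* u :* (b :* u)) refl b u)
    (trans (*-cong bu≈1 bu≈1) (*-identityˡ 1#))

-- Polynomial rings over ℤ and ℚ

open import Defs hiding (_≈_; _+_; _*_; -_; 0#; 1#; _^_; _-_)

module PolynomialRing {c ℓ : Level} (R : CommutativeRing c ℓ) where
  private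
    module R = CommutativeRing R
    open R using (_≈_; _+_; _*_; -_; 0#; 1#)
    module S = PowerSeries R
  open Polynomial R.rawRing

  coeff-⊕′ : ∀ f g n → coeff (f ⊕ g) n ≈ coeff f n + coeff g n
  coeff-⊕′ []      g       n       = R.sym (R.+-identityˡ _)
  coeff-⊕′ (a ∷ f) []      n       = R.sym (R.+-identityʳ _)
  coeff-⊕′ (a ∷ f) (b ∷ g) zero    = R.refl
  coeff-⊕′ (a ∷ f) (b ∷ g) (suc n) = coeff-⊕′ f g n

  coeff-map : ∀ (h : R.Carrier → R.Carrier) → h 0# ≈ 0# → ∀ f n → coeff (List.map h f) n ≈ h (coeff f n)
  coeff-map h h0≈0 []      n       = R.sym h0≈0
  coeff-map h h0≈0 (a ∷ f) zero    = R.refl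
  coeff-map h h0≈0 (a ∷ f) (suc n) = coeff-map h h0≈0 f n

  coeff-⊛ : ∀ f g n → coeff (f ⊛ g) n ≈ S.conv (coeff f) (coeff g) n
  coeff-⊛ []      g n = R.sym (S.conv-zeroˡ (coeff g) n)
  coeff-⊛ (a ∷ f) g n = R.trans (coeff-⊕′ (List.map (a *_) g) (0# ∷ f ⊛ g) n)
    (R.trans (R.+-congʳ (coeff-map (a *_) (R.zeroʳ a) g n)) (step n))
    where
    step : ∀ n → a * coeff g n + coeff (0# ∷ f ⊛ g) n ≈ S.conv (coeff (a ∷ f)) (coeff g) n
    step zero    = R.+-identityʳ _
    step (suc n) = R.+-congˡ (coeff-⊛ f g n)

  -- Coefficient lists up to trailing zeros embed into power series, so the ring axioms are pulled
  -- back from there.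
  coeff-isRingMonomorphism : IsRingMonomorphism rawRing S.rawRing coeff
  coeff-isRingMonomorphism = record
    { isRingHomomorphism = record
      { isSemiringHomomorphism = record
        { isNearSemiringHomomorphism = record
          { +-isMonoidHomomorphism = record
            { isMagmaHomomorphism = record
              { isRelHomomorphism = record { cong = λ f≈g → f≈g }
              ; homo              = coeff-⊕′
              }
            ; ε-homo = λ _ → R.refl
            }
          ; *-homo = coeff-⊛
          }
        ; 1#-homo = λ { zero → R.refl ; (suc n) → R.refl }
        }
      ; -‿homo = coeff-map -_ -0#≈0#
      }
    ; injective = λ f≈g → f≈g
    }
    where open import Algebra.Properties.Ring R.ring using (-0#≈0#)

  commutativeRing : CommutativeRing c ℓ
  commutativeRing = record
    { RawRing rawRing
    ; isCommutativeRing = RingMonomorphism.isCommutativeRing coeff-isRingMonomorphism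
        (CommutativeRing.isCommutativeRing S.commutativeRing)
    }

ℤ[q]-commutativeRing ℚ[q]-commutativeRing : CommutativeRing _ _
ℤ[q]-commutativeRing = PolynomialRing.commutativeRing ℤ.+-*-commutativeRing
ℚ[q]-commutativeRing = PolynomialRing.commutativeRing ℚ.+-*-commutativeRing

fromℤ : ℤ → ℚ
fromℤ i = i ℚ./ 1

-- Rationals are stored in lowest terms, so the computation passes to unnormalised fractions, where
-- the sum of integers is visible.
fromℤ-+ : ∀ i j → fromℤ (i ℤ.+ j) ≡ fromℤ i ℚ.+ fromℤ j
fromℤ-+ i j = ℚ.toℚᵘ-injective (begin
  ℚ.toℚᵘ (fromℤ (i ℤ.+ j))                    ≈⟨ ℚ.toℚᵘ-fromℚᵘ (ℚᵘ.mkℚᵘ (i ℤ.+ j) 0) ⟩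
  ℚᵘ.mkℚᵘ (i ℤ.+ j) 0
    ≈⟨ ℚᵘ.*≡* (≡.cong (ℤ._* 1ℤ) (≡.cong₂ ℤ._+_ (≡.sym (ℤ.*-identityʳ i)) (≡.sym (ℤ.*-identityʳ j)))) ⟩
  ℚᵘ.mkℚᵘ i 0 ℚᵘ.+ ℚᵘ.mkℚᵘ j 0
    ≈⟨ ℚᵘ.+-cong (ℚ.toℚᵘ-fromℚᵘ (ℚᵘ.mkℚᵘ i 0)) (ℚ.toℚᵘ-fromℚᵘ (ℚᵘ.mkℚᵘ j 0)) ⟨
  ℚ.toℚᵘ (fromℤ i) ℚᵘ.+ ℚ.toℚᵘ (fromℤ j)      ≈⟨ ℚ.toℚᵘ-homo-+ (fromℤ i) (fromℤ j) ⟨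
  ℚ.toℚᵘ (fromℤ i ℚ.+ fromℤ j)                ∎)
  where open ≈-Reasoning ℚᵘ.≃-setoid

fromℤ-* : ∀ i j → fromℤ (i ℤ.* j) ≡ fromℤ i ℚ.* fromℤ j
fromℤ-* i j = ℚ.toℚᵘ-injective (begin
  ℚ.toℚᵘ (fromℤ (i ℤ.* j))                    ≈⟨ ℚ.toℚᵘ-fromℚᵘ (ℚᵘ.mkℚᵘ (i ℤ.* j) 0) ⟩
  ℚᵘ.mkℚᵘ i 0 ℚᵘ.* ℚᵘ.mkℚᵘ j 0
    ≈⟨ ℚᵘ.*-cong (ℚ.toℚᵘ-fromℚᵘ (ℚᵘ.mkℚᵘ i 0)) (ℚ.toℚᵘ-fromℚᵘ (ℚᵘ.mkℚᵘ j 0)) ⟨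
  ℚ.toℚᵘ (fromℤ i) ℚᵘ.* ℚ.toℚᵘ (fromℤ j)      ≈⟨ ℚ.toℚᵘ-homo-* (fromℤ i) (fromℤ j) ⟨
  ℚ.toℚᵘ (fromℤ i ℚ.* fromℤ j)                ∎)
  where open ≈-Reasoning ℚᵘ.≃-setoid

reciprocal : ∀ n → (+ 1 ℚ./ suc n) ℚ.* fromℤ (+ suc n) ≡ ℚ.1ℚ
reciprocal n = ℚ.toℚᵘ-injective (begin
  ℚ.toℚᵘ ((+ 1 ℚ./ suc n) ℚ.* fromℤ (+ suc n))
    ≈⟨ ℚ.toℚᵘ-homo-* (+ 1 ℚ./ suc n) (fromℤ (+ suc n)) ⟩
  ℚ.toℚᵘ (+ 1 ℚ./ suc n) ℚᵘ.* ℚ.toℚᵘ (fromℤ (+ suc n))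
    ≈⟨ ℚᵘ.*-cong (ℚ.toℚᵘ-fromℚᵘ (ℚᵘ.mkℚᵘ (+ 1) n)) (ℚ.toℚᵘ-fromℚᵘ (ℚᵘ.mkℚᵘ (+ suc n) 0)) ⟩
  ℚᵘ.mkℚᵘ (+ 1) n ℚᵘ.* ℚᵘ.mkℚᵘ (+ suc n) 0
    ≈⟨ ℚᵘ.*≡* (≡.trans (ℤ.*-identityʳ (+ 1 ℤ.* + suc n))
         (≡.trans (ℤ.*-identityˡ (+ suc n))
         (≡.trans (≡.cong +_ (≡.sym (ℕ.*-identityʳ (suc n)))) (≡.sym (ℤ.*-identityˡ _))))) ⟩
  ℚᵘ.1ℚᵘ ∎)
  where open ≈-Reasoning ℚᵘ.≃-setoid

module ℤᵖ = CommutativeRing ℤ[q]-commutativeRing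
module ℚᵖ = CommutativeRing ℚ[q]-commutativeRing

module _ where
  open Polynomial ℚ.+-*-rawRing using () renaming (coeff to coeffℚ)
  private
    module ZR = PolynomialRing ℤ.+-*-commutativeRing
    module QR = PolynomialRing ℚ.+-*-commutativeRing
    module ZS = PowerSeries ℤ.+-*-commutativeRing
    module QS = PowerSeries ℚ.+-*-commutativeRing
    ι = ℤ[q]→ℚ[q]

  coeff-ι : ∀ f n → coeffℚ (ι f) n ≡ fromℤ (ℤ[q].coeff f n)
  coeff-ι []      n       = ≡.refl
  coeff-ι (a ∷ f) zero    = ≡.refl
  coeff-ι (a ∷ f) (suc n) = coeff-ι f n

  ι-cong : ∀ {f g} → f ℤᵖ.≈ g → ι f ℚᵖ.≈ ι g
  ι-cong {f} {g} f≈g n =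
    ≡.trans (coeff-ι f n) (≡.trans (≡.cong fromℤ (f≈g n)) (≡.sym (coeff-ι g n)))

  ι-+ : ∀ f g → ι (f ℤᵖ.+ g) ℚᵖ.≈ ι f ℚᵖ.+ ι g
  ι-+ f g n = begin
    coeffℚ (ι (f ℤᵖ.+ g)) n                               ≡⟨ coeff-ι (f ℤᵖ.+ g) n ⟩
    fromℤ (ℤ[q].coeff (f ℤᵖ.+ g) n)                       ≡⟨ ≡.cong fromℤ (coeff-⊕ f g n) ⟩
    fromℤ (ℤ[q].coeff f n ℤ.+ ℤ[q].coeff g n)             ≡⟨ fromℤ-+ (ℤ[q].coeff f n) (ℤ[q].coeff g n) ⟩
    fromℤ (ℤ[q].coeff f n) ℚ.+ fromℤ (ℤ[q].coeff g n)     ≡⟨ ≡.cong₂ ℚ._+_ (coeff-ι f n) (coeff-ι g n) ⟨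
    coeffℚ (ι f) n ℚ.+ coeffℚ (ι g) n                     ≡⟨ QR.coeff-⊕′ (ι f) (ι g) n ⟨
    coeffℚ (ι f ℚᵖ.+ ι g) n                               ∎
    where open ≡.≡-Reasoning

  fromℤ-conv : ∀ f g n → fromℤ (ZS.conv f g n) ≡ QS.conv (fromℤ ∘ f) (fromℤ ∘ g) n
  fromℤ-conv f g zero    = fromℤ-* (f 0) (g 0)
  fromℤ-conv f g (suc n) = ≡.trans (fromℤ-+ (f 0 ℤ.* g (suc n)) (ZS.conv (f ∘ suc) g n))
    (≡.cong₂ ℚ._+_ (fromℤ-* (f 0) (g (suc n))) (fromℤ-conv (f ∘ suc) g n))

  ι-* : ∀ f g → ι (f ℤᵖ.* g) ℚᵖ.≈ ι f ℚᵖ.* ι g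
  ι-* f g n = begin
    coeffℚ (ι (f ℤᵖ.* g)) n                               ≡⟨ coeff-ι (f ℤᵖ.* g) n ⟩
    fromℤ (ℤ[q].coeff (f ℤᵖ.* g) n)                       ≡⟨ ≡.cong fromℤ (ZR.coeff-⊛ f g n) ⟩
    fromℤ (ZS.conv (ℤ[q].coeff f) (ℤ[q].coeff g) n)       ≡⟨ fromℤ-conv _ _ n ⟩
    QS.conv (fromℤ ∘ ℤ[q].coeff f) (fromℤ ∘ ℤ[q].coeff g) n
      ≡⟨ QS.conv-cong (coeff-ι f) (coeff-ι g) n ⟨
    QS.conv (coeffℚ (ι f)) (coeffℚ (ι g)) n               ≡⟨ QR.coeff-⊛ (ι f) (ι g) n ⟨
    coeffℚ (ι f ℚᵖ.* ι g) n                               ∎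
    where open ≡.≡-Reasoning

-- Constants and q-numbers as integer polynomials

open Multiples ℤᵖ.semiring using () renaming (_×_ to _·_)

multiple≈constant : ∀ n → n · ℤᵖ.1# ℤᵖ.≈ (+ n ∷ [])
multiple≈constant zero    zero    = ≡.refl
multiple≈constant zero    (suc k) = ≡.refl
multiple≈constant (suc n) k = ≡.trans (coeff-⊕ ℤᵖ.1# (n · ℤᵖ.1#) k)
  (≡.trans (≡.cong (λ c → ℤ[q].coeff ℤᵖ.1# k ℤ.+ c) (multiple≈constant n k)) (add k))
  where
  add : ∀ k → ℤ[q].coeff ℤᵖ.1# k ℤ.+ ℤ[q].coeff (+ n ∷ []) k ≡ ℤ[q].coeff (+ suc n ∷ []) k
  add zero    = ≡.refl
  add (suc k) = ≡.refl

[suc]≈1+q* : ∀ n → [ suc n ]q ℤᵖ.≈ ℤᵖ.1# ℤᵖ.+ (0ℤ ∷ 1ℤ ∷ []) ℤᵖ.* [ n ]q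
[suc]≈1+q* n k = ≡.sym (≡.trans (coeff-⊕ ℤᵖ.1# ((0ℤ ∷ 1ℤ ∷ []) ℤᵖ.* [ n ]q) k) (add k))
  where
  add : ∀ k → ℤ[q].coeff ℤᵖ.1# k ℤ.+ ℤ[q].coeff ((0ℤ ∷ 1ℤ ∷ []) ℤᵖ.* [ n ]q) k ≡ ℤ[q].coeff [ suc n ]q k
  add zero    = ≡.cong (λ c → 1ℤ ℤ.+ c) (coeff-⊛-zero 0ℤ (1ℤ ∷ []) [ n ]q)
  add (suc k) = ≡.trans (ℤ.+-identityˡ _)
    (≡.trans (coeff-⊛-suc 0ℤ (1ℤ ∷ []) [ n ]q k)
    (≡.trans (ℤ.+-identityˡ _) (ℤᵖ.*-identityˡ [ n ]q k)))

ι-multiple-invertible : ∀ n → ∃ λ k → k ℚᵖ.* ℤ[q]→ℚ[q] (suc n · ℤᵖ.1#) ℚᵖ.≈ ℚᵖ.1#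
ι-multiple-invertible n = k , λ i → ≡.trans
  (ℚᵖ.*-congˡ {k} {ℤ[q]→ℚ[q] (suc n · ℤᵖ.1#)} {fromℤ (+ suc n) ∷ []}
    (ι-cong {suc n · ℤᵖ.1#} {+ suc n ∷ []} (multiple≈constant (suc n))) i)
  (product i)
  where
  k : ℚᵖ.Carrier
  k = (+ 1 ℚ./ suc n) ∷ []
  product : k ℚᵖ.* (fromℤ (+ suc n) ∷ []) ℚᵖ.≈ ℚᵖ.1#
  product zero    = ≡.trans (ℚ.+-identityʳ _) (reciprocal n)
  product (suc i) = ≡.refl

open Defs using (_≈_; _+_; _*_; -_; 0#; 1#; _^_; _-_)

-- The indeterminate as a polynomial, abstract so that products with it do not reduce.

abstract
  q̄ : ℤ[q].Carrier
  q̄ = 0ℤ ∷ 1ℤ ∷ []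

  fromPoly-q̄ : fromPoly q̄ ≡ q
  fromPoly-q̄ = ≡.refl

  [suc]≈1+q̄* : ∀ n → [ suc n ]q ℤᵖ.≈ ℤᵖ.1# ℤᵖ.+ q̄ ℤᵖ.* [ n ]q
  [suc]≈1+q̄* = [suc]≈1+q*

-- Residues of rational functions and the congruence

All-subsequences : ∀ {A : Set} {P : A → Set} l {xs} → All P xs →
                   All (VecAll.All P) (subsequences l xs)
All-subsequences zero    pxs        = [] ∷ []
All-subsequences (suc l) []         = []
All-subsequences (suc l) (px ∷ pxs) = All.++⁺
  (All.map⁺ (All.map (px ∷_) (All-subsequences l pxs))) (All-subsequences (suc l) pxs)

module Residues (Φ : ℤ[q].Carrier) where
  open TorsionFreeQuotient ℤ[q]-commutativeRing Φ public
    using (_~_; witness; ≈⇒~; Φ~0; Regular; regular; Regular-*; Regular-cong; unit-regular;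
           multiple-regular; Regular⇒nonZeroDivisor)
    renaming (commutativeRing to S)
  private module S = CommutativeRing S
  open IntegerSolver S
  open Exponentiation S.semiring using () renaming (_^_ to _^ₛ_)
  open ℚ⟨q⟩
  open FractionIdentities using (cross; numerator-vanishes)

  Regular⇒coprime : ∀ {d} → Regular d → ℚ[q].Coprime (ℤ[q]→ℚ[q] d) (ℤ[q]→ℚ[q] Φ)
  Regular⇒coprime d-regular {z} record { quotient = a ; equality = az≈d } record { quotient = b ; equality = bz≈Φ } =
    record { quotient = proj₁ inverse ; equality = proj₂ inverse }
    where
    open RegularImage ℤ[q]-commutativeRing ℚ[q]-commutativeRing ℤ[q]→ℚ[q]
      (λ {f} {g} → ι-cong {f} {g}) ι-+ ι-*
    inverse = commonDivisor-invertible d-regular ι-multiple-invertible z a b az≈d bz≈Φ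

  -- The rational function x has a denominator that is regular modulo Φ and reduces to the residue
  -- v; writing this as numerator ~ v · denominator spares an inverse of the denominator.
  record Value (x : ℚ⟨q⟩) (v : ℤ[q].Carrier) : Set where
    field
      regular-den : Regular (den x)
      num~        : num x ~ v ℤᵖ.* den x

  open Value

  Value-poly : ∀ f → Value (fromPoly f) f
  Value-poly f = record
    { regular-den = unit-regular {ℤᵖ.1#} {ℤᵖ.1#} (S.*-identityˡ ℤᵖ.1#)
    ; num~        = S.sym (S.*-identityʳ f)
    }

  Value-0 : Value 0# S.0#
  Value-0 = Value-poly ℤᵖ.0#

  Value-1 : Value 1# S.1#
  Value-1 = Value-poly ℤᵖ.1#

  Value-+ : ∀ {x y v w} → Value x v → Value y w → Value (x + y) (v S.+ w)
  Value-+ {x} {y} {v} {w} X Y = record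
    { regular-den = Regular-* (regular-den X) (regular-den Y)
    ; num~        = begin
        num x S.* den y S.+ num y S.* den x
          ≈⟨ S.+-cong (S.*-congʳ {den y} (num~ X)) (S.*-congʳ {den x} (num~ Y)) ⟩
        v S.* den x S.* den y S.+ w S.* den y S.* den x
          ≈⟨ solve 4 (λ v w d e → v :* d :* e :+ w :* e :* d := (v :+ w) :* (d :* e)) S.refl v w (den x) (den y) ⟩
        (v S.+ w) S.* (den x S.* den y) ∎
    }
    where open ≈-Reasoning S.setoid

  Value-* : ∀ {x y v w} → Value x v → Value y w → Value (x * y) (v S.* w)
  Value-* {x} {y} {v} {w} X Y = record
    { regular-den = Regular-* (regular-den X) (regular-den Y)
    ; num~        = begin
        num x S.* num y                      ≈⟨ S.*-cong (num~ X) (num~ Y) ⟩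
        v S.* den x S.* (w S.* den y)
          ≈⟨ solve 4 (λ v w d e → v :* d :* (w :* e) := v :* w :* (d :* e)) S.refl v w (den x) (den y) ⟩
        v S.* w S.* (den x S.* den y)        ∎
    }
    where open ≈-Reasoning S.setoid

  Value-neg : ∀ {x v} → Value x v → Value (- x) (S.- v)
  Value-neg {x} {v} X = record
    { regular-den = regular-den X
    ; num~        = S.trans (S.-‿cong (num~ X))
        (solve 2 (λ v d → :- (v :* d) := :- v :* d) S.refl v (den x))
    }

  Value-^ : ∀ {x v} → Value x v → ∀ n → Value (x ^ n) (v ^ₛ n)
  Value-^ X zero    = Value-1
  Value-^ X (suc n) = Value-* X (Value-^ X n)

  Value-inverse : ∀ {d u d≉0} → d S.* u ~ S.1# → Value (frac ℤᵖ.1# d d≉0) u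
  Value-inverse {d} {u} du~1 = record
    { regular-den = unit-regular {d} {u} du~1
    ; num~        = S.trans (S.sym du~1) (S.*-comm d u)
    }

  Value-subst : ∀ {x v w} → v ~ w → Value x v → Value x w
  Value-subst {x} v~w X = record
    { regular-den = regular-den X
    ; num~        = S.trans (num~ X) (S.*-congʳ {den x} v~w)
    }

  *-≉0-multiple : ∀ n {d} → d ℤ[q].≉ ℤ[q].0# → suc n · ℤᵖ.1# ℤᵖ.* d ℤ[q].≉ ℤ[q].0#
  *-≉0-multiple n {d} = *-≉0 {suc n · ℤᵖ.1#} {d} λ n≈0 →
    constant≉0 (suc n) λ k → ≡.trans (≡.sym (multiple≈constant (suc n) k)) (n≈0 k)

  -- The hypothesis n v ~ w expresses v = w / n among residues, where n need not be a unit.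
  difference~0 : ∀ {x y v w} n .{{_ : NonZero n}} → Value x v → Value y w →
    n · ℤᵖ.1# S.* v ~ w → num (x - y /ℕ n) ~ S.0#
  difference~0 {x} {y} {v} {w} (suc n) X Y nv~w =
    numerator-vanishes S (num x) (den x) (num y) (den y) (+ suc n ∷ []) v w (num~ X) (num~ Y)
      (S.trans (S.*-congʳ {v} {N} {suc n · ℤᵖ.1#} (≈⇒~ {N} (ℤᵖ.sym {suc n · ℤᵖ.1#} {N} (multiple≈constant (suc n))))) nv~w)
    where N = + suc n ∷ []

  difference-regular : ∀ {x y v w} n .{{_ : NonZero n}} → Value x v → Value y w →
    Regular (den (x - y /ℕ n))
  difference-regular (suc n) X Y = Regular-* (regular-den X) (Regular-* (regular-den Y)
    (Regular-cong {suc n · ℤᵖ.1#} {+ suc n ∷ []} (multiple≈constant (suc n)) (multiple-regular n)))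

  -- From f ~ 0 one only learns that Φ divides an integer multiple of f; expanding the fraction by
  -- that integer keeps its denominator regular, hence coprime to Φ.
  vanishing : ∀ f g (g≉0 : g ℤ[q].≉ ℤ[q].0#) → f ~ S.0# → Regular g →
    ∃₂ λ f′ g′ → Σ[ g′≉0 ∈ g′ ℤ[q].≉ ℤ[q].0# ]
      frac f g g≉0 ≈ frac f′ g′ g′≉0 × ℚ[q].Coprime (ℤ[q]→ℚ[q] g′) (ℤ[q]→ℚ[q] Φ) × Φ ℤ[q].∣ f′
  vanishing f g g≉0 (witness m u eq) g-regular =
    M ℤᵖ.* (f ℤᵖ.- ℤᵖ.0#) , M ℤᵖ.* g , *-≉0-multiple m {g} g≉0 ,
    cross ℤ[q]-commutativeRing M f g ,
    Regular⇒coprime {M ℤᵖ.* g} (Regular-* {M} {g} (multiple-regular m) g-regular) ,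
    record { quotient = u ; equality = ℤᵖ.sym {M ℤᵖ.* (f ℤᵖ.- ℤᵖ.0#)} {u ℤᵖ.* Φ} eq }
    where M = suc m · ℤᵖ.1#

  congruence : ∀ {x y v w} n .{{_ : NonZero n}} → Value x v → Value y w →
    n · ℤᵖ.1# S.* v ~ w → x ≡ y /ℕ n [mod Φ ]
  congruence {x} {y} n X Y nv~w =
    vanishing (num z) (den z) (den≉0 z) (difference~0 n X Y nv~w) (difference-regular n X Y)
    where z = x - y /ℕ n

  open SubsequenceSums S using (esym; sum; product; sum-subsequences)

  Value-inverse-square : ∀ {d u d²≉0} → d S.* u ~ S.1# → Value (frac ℤᵖ.1# (d ℤ[q].^ 2) d²≉0) (u S.* u)
  Value-inverse-square {d} {u} du~1 =
    Value-inverse {d ℤ[q].^ 2} {u S.* u} (InverseSquare.inverse-square S {d} {u} du~1)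

  Value-factor₂ : ∀ j {v u} → Value (q ^ (1 ℕ.* suc j)) v → [ suc j ]q S.* u ~ S.1# →
    Value (factor 2 j) (v S.* (u S.* u))
  Value-factor₂ j {v} {u} Q inverse =
    Value-* {q ^ (1 ℕ.* suc j)} {frac ℤᵖ.1# ([ suc j ]q ℤ[q].^ 2) (^-≉0 {[ suc j ]q} 2 [suc j ]q≉0)} Q
      (Value-inverse-square {[ suc j ]q} {u} inverse)

  Value-sum : ∀ {A : Set} {F : A → ℚ⟨q⟩} {f : A → ℤ[q].Carrier} {xs} →
    All (λ x → Value (F x) (f x)) xs →
    Value (List.foldr _+_ 0# (List.map F xs)) (sum (List.map f xs))
  Value-sum []                = Value-0
  Value-sum (value ∷ values) = Value-+ value (Value-sum values)

  Value-product : ∀ {s l x} {js : Vec ℕ l} → VecAll.All (λ j → Value (factor s j) (x j)) js →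
    Value (Vec.foldr′ _*_ 1# (Vec.zipWith factor (replicate l s) js)) (product (Vec.map x js))
  Value-product []               = Value-1
  Value-product (value ∷ values) = Value-* value (Value-product values)

  Value-H : ∀ n s t x → (∀ j → j < n → Value (factor s j) (x j)) →
    Value (H n (replicate t s)) (esym t (List.applyUpTo x n))
  Value-H n s t x values = Value-subst
    (≡.subst (λ xs → sum (List.map (product ∘ Vec.map x) (subsequences t (List.upTo n))) ~ esym t xs)
      (List.map-upTo x n) (sum-subsequences x t (List.upTo n)))
    (Value-sum (All.map Value-product (All-subsequences t
      (All.applyUpTo⁺₁ (λ j → j) n (λ {j} j<n → values j j<n)))))

  module _ (n : ℕ) (Φ≡[1+n]q : Φ ≡ [ suc n ]q) where
    open Multiples S.semiring using () renaming (_×_ to _·ₛ_)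

    open QNumbers S q̄ using (⟦_⟧; ⟦⟧-unique)

    -- Both multiples use the same addition on the same carrier, but belong to monoids with
    -- different equalities, so for variable k they are identified by induction.
    multiple≡ : ∀ k → k · ℤᵖ.1# ≡ k ·ₛ S.1#
    multiple≡ zero    = ≡.refl
    multiple≡ (suc k) = ≡.cong (λ x → ℤᵖ.1# ℤᵖ.+ x) (multiple≡ k)

    multiple~constant : ∀ k → k ·ₛ S.1# ~ (+ k ∷ [])
    multiple~constant k = ≡.subst (_~ (+ k ∷ [])) (multiple≡ k)
      (≈⇒~ {k · ℤᵖ.1#} {+ k ∷ []} (multiple≈constant k))

    []q~⟦⟧ : ∀ k → [ k ]q ~ ⟦ k ⟧
    []q~⟦⟧ = ⟦⟧-unique [_]q S.refl
      λ k → ≈⇒~ {[ suc k ]q} {ℤᵖ.1# ℤᵖ.+ q̄ ℤᵖ.* [ k ]q} ([suc]≈1+q̄* k)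

    ⟦1+n⟧~0 : ⟦ suc n ⟧ ~ S.0#
    ⟦1+n⟧~0 = S.trans (S.sym ([]q~⟦⟧ (suc n))) (≡.subst (_~ S.0#) Φ≡[1+n]q Φ~0)

    1+n-nonZeroDivisor : ∀ x → suc n ·ₛ S.1# S.* x ~ S.0# → x ~ S.0#
    1+n-nonZeroDivisor = ≡.subst (λ a → ∀ x → a S.* x ~ S.0# → x ~ S.0#) (multiple≡ (suc n))
      (Regular⇒nonZeroDivisor (multiple-regular n))

    inverses : Prime (suc n) → ∃ λ (u : ℕ → ℤ[q].Carrier) → ∀ j → j < n → ⟦ suc j ⟧ S.* u j ~ S.1#
    inverses p-prime = QNumberInverses.⟦⟧-inverses S q̄ p-prime ⟦1+n⟧~0

    module _ (u : ℕ → ℤ[q].Carrier) (⟦1+j⟧u~1 : ∀ j → j < n → ⟦ suc j ⟧ S.* u j ~ S.1#) where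
      open Cyclotomic S q̄ n ⟦1+n⟧~0 1+n-nonZeroDivisor u ⟦1+j⟧u~1 using (x; esym-formula)

      [1+j]u~1 : ∀ j → j < n → [ suc j ]q S.* u j ~ S.1#
      [1+j]u~1 j j<n = S.trans (S.*-congʳ {u j} ([]q~⟦⟧ (suc j))) (⟦1+j⟧u~1 j j<n)

      Value-q : Value q q̄
      Value-q = ≡.subst (λ y → Value y q̄) fromPoly-q̄ (Value-poly q̄)

      Value-x : ∀ j → j < n → Value (factor 2 j) (x j)
      Value-x j j<n = Value-factor₂ j {q̄ ^ₛ (1 ℕ.* suc j)} {u j}
        (Value-^ {q} {q̄} Value-q (1 ℕ.* suc j)) ([1+j]u~1 j j<n)

      residue-formula : ∀ t → t ≤ n →
        (suc n ℕ.* suc t) · ℤᵖ.1# S.* esym t (List.applyUpTo x n) ~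
        (S.- S.1#) ^ₛ t S.* (+ ((suc n ℕ.+ t) C (2 ℕ.* t ℕ.+ 1)) ∷ []) S.* (S.1# S.- q̄) ^ₛ (2 ℕ.* t)
      residue-formula t t≤n = S.trans
        (S.reflexive (≡.cong (S._* esym t (List.applyUpTo x n)) (multiple≡ (suc n ℕ.* suc t))))
        (S.trans (esym-formula t t≤n)
          (S.*-congʳ {(S.1# S.- q̄) ^ₛ (2 ℕ.* t)} (S.*-congˡ {(S.- S.1#) ^ₛ t} (multiple~constant m))))
        where m = (suc n ℕ.+ t) C (2 ℕ.* t ℕ.+ 1)

      Value-rhs : ∀ t m → Value ((- 1#) ^ t * fromℕ m * (1# - q) ^ (2 ℕ.* t))
        ((S.- S.1#) ^ₛ t S.* (+ m ∷ []) S.* (S.1# S.- q̄) ^ₛ (2 ℕ.* t))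
      Value-rhs t m = Value-*
        (Value-* (Value-^ (Value-neg Value-1) t) (Value-poly (+ m ∷ [])))
        (Value-^ (Value-+ Value-1 (Value-neg Value-q)) (2 ℕ.* t))

      H-congruence : ∀ t .{{_ : NonZero (suc n ℕ.* suc t)}} → t ≤ n →
        H n (replicate t 2)
        ≡ _/ℕ_ ((- 1#) ^ t * fromℕ ((suc n ℕ.+ t) C (2 ℕ.* t ℕ.+ 1)) * (1# - q) ^ (2 ℕ.* t))
            (suc n ℕ.* suc t)
        [mod Φ ]
      H-congruence t t≤n =
        congruence (suc n ℕ.* suc t)
          (Value-H n 2 t x Value-x)
          (Value-rhs t ((suc n ℕ.+ t) C (2 ℕ.* t ℕ.+ 1)))
          (residue-formula t t≤n)

theorem4p1 : ∀ (t p : ℕ) → t ≥ 1 → (prime : Prime p) → t < p →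
    H (p ∸ 1) (replicate t 2)
    ≡ _/ℕ_ ((- 1#) ^ t * fromℕ ((p ℕ.+ t) C (2 ℕ.* t ℕ.+ 1)) * (1# - q) ^ (2 ℕ.* t))
    (p ℕ.* suc t) {{m*n≢0 p (suc t) {{prime⇒nonZero prime}}}}
    [mod [ p ]q ]
theorem4p1 t (suc n) t≥1 p-prime (s≤s t≤n) =
  -- With p = n + 1, the hypothesis t < p is t ≤ n, the range in which forms of degree n determine
  -- their coefficients.
  Residues.H-congruence [ suc n ]q n ≡.refl (proj₁ inverses) (proj₂ inverses)
    t {{m*n≢0 (suc n) (suc t) {{prime⇒nonZero p-prime}}}} t≤n
  where inverses = Residues.inverses [ suc n ]q n ≡.refl p-prime
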